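{- Let $(W,S)$ be a Coxeter system, let $J\subseteq S$, and let $X\subseteq T$ be an order ideal of $(T,\sqsubseteq)$. Then the map $P^J:W\to W$ is order preserving on $(W,\leqslant_{L^X})$: $u\leqslant_{L^X}v$ implies $P^J(u)\leqslant_{L^X}P^J(v)$. In particular, this holds for the $k$-intermediate orders $\leqslant_{L^k}$, for every $k\in\mathbb N$.
   Context: $(W,S)$ is a Coxeter system with length function $\ell$, reflections $T=\{wsw^{ -1}:w\in W,\ s\in S\}$ and Bruhat order $\leqslant$. For $X\subseteq T$, $u\leqslant_{L^X}v$ iff $u=v$, or $\ell(u)<\ell(v)$ and there exist $t_1,\dots,t_r\in X$ with $u<t_1u<\dots<t_r\cdots t_1u=v$ in the Bruhat order. For $k\in\mathbb N$, let $T_k=\{t\in T:(\ell(t)-1)/2\leqslant k\}$ and $\leqslant_{L^k}:=\leqslant_{L^{T_k}}$. The Bruhat graph $\Omega_{W,S}$ has vertex set $W$ and an arrow $u\to v$ iff $uv^{ -1}\in T$ and $u<v$; $\Omega_{W,S}(Y)$ is its induced subgraph on $Y$. A reflection subgroup $W'$ (a subgroup generated by reflections) has canonical Coxeter generators $S'=\{t\in T:N(t)\cap W'=\{t\}\}$, where $N(v)=\{t\in T:\ell(tv)<\ell(v)\}$; it is dihedral if $|S'|=2$. $t\sqsubseteq' t'$ iff $t=t'$ or there is a dihedral reflection subgroup $W'\ni t,t'$ such that the directed distance from $t$ to $t'$ in $\Omega_{W,S}(W')$ is finite; $\sqsubseteq$ is the transitive closure of $\sqsubseteq'$. For $J\subseteq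 S$, $W_J$ is the subgroup generated by $J$ and $W^J=\{w\in W:\ell(w)<\ell(ws)\ \forall s\in J\}$. Every $w$ factors uniquely as $w=w^Jw_J$ with $w^J\in W^J$, $w_J\in W_J$ and $\ell(w)=\ell(w^J)+\ell(w_J)$. Set $P^J(w):=w^J$. -}

module Defs where

open import Algebra.Bundles using (Group)
open import Axiom.ExcludedMiddle using (ExcludedMiddle)
open import Data.List.Base using (List; []; _∷_; _++_; length; foldr; concat; replicate)
open import Data.List.Properties using (length-++)
open import Data.Nat.Base using (ℕ; zero; suc; _+_; _∸_; _/_; _≤_; _<_; z≤n; s≤s; parity)
open import Data.Nat.Properties using (+-comm; +-assoc; +-identityʳ; +-monoʳ-≤; ≤-antisym; ≤-trans; ≤-reflexive; ≮⇒≥; ≤∧≢⇒<; module ≤-Reasoning)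
open import Data.Nat.Induction using (<-wellFounded)
open import Data.Parity.Base using (0ℙ) renaming (_+_ to _+ℙ_; _⁻¹ to _⁻¹ℙ)
open import Data.Parity.Properties using (+-homo-+; p≢p⁻¹; suc-homo-⁻¹)
open import Data.Product.Base using (Σ; ∃; ∃₂; _×_; _,_; proj₁; proj₂)
open import Data.Sum.Base using (_⊎_)
open import Function.Base using (_∘_)
open import Induction.WellFounded using (Acc; acc)
open import Level using (Level) renaming (suc to lsuc)
open import Relation.Binary.Construct.Closure.Transitive using (TransClosure)
import Relation.Binary.Construct.NonStrictToStrict as NonStrictToStrict
open import Relation.Binary.PropositionalEquality using (_≡_; _≢_; refl; sym; trans; cong; cong₂; subst; module ≡-Reasoning)
open import Relation.Nullary.Decidable.Core using (Dec; yes; no)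
open import Relation.Nullary.Negation.Core using (contradiction)
open import Relation.Unary using (Pred; _∈_; _⊆_; _∩_; _≐_)

private
  least : ∀ {p} (P : ℕ → Set p) → (∀ n → Dec (P n)) → ∀ n → P n →
          ∃ λ m → P m × (∀ k → P k → m ≤ k)
  least P P? zero    p = 0 , p , λ _ _ → z≤n
  least P P? (suc n) p with P? 0
  ... | yes p₀ = 0 , p₀ , λ _ _ → z≤n
  ... | no ¬p₀ with least (P ∘ suc) (P? ∘ suc) n p
  ...   | m , pm , min = suc m , pm , λ where
            zero    p₀ → contradiction p₀ ¬p₀
            (suc k) pk → s≤s (min k pk)

-- The entry 0 stands for ∞: the relator (st)⁰ is the empty word.
record CoxeterMatrix {a} (S : Set a) : Set a where
  field
    m         : S → S → ℕ
    symmetric : ∀ s t → m s t ≡ m t s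
    diagonal  : ∀ s → m s s ≡ 1
    off-diag  : ∀ s t → s ≢ t → m s t ≢ 1

module Presentation {a} {S : Set a} (M : CoxeterMatrix S) where
  open CoxeterMatrix M

  relator : S → S → List S
  relator s t = concat (replicate (m s t) (s ∷ t ∷ []))

  -- Words without inverse letters suffice, because the relator (ss)¹ makes
  -- every generator its own inverse.
  data _∼_ : List S → List S → Set a where
    ∼-refl  : ∀ {u} → u ∼ u
    ∼-sym   : ∀ {u v} → u ∼ v → v ∼ u
    ∼-trans : ∀ {u v w} → u ∼ v → v ∼ w → u ∼ w
    ∼-rel   : ∀ u s t v → (u ++ relator s t ++ v) ∼ (u ++ v)

  private
    parity-pairs : ∀ (s t : S) n → parity (length (concat (replicate n (s ∷ t ∷ [])))) ≡ 0ℙ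
    parity-pairs s t zero    = refl
    parity-pairs s t (suc n) = parity-pairs s t n

    parity-++ : ∀ (u v : List S) → parity (length (u ++ v)) ≡ parity (length u) +ℙ parity (length v)
    parity-++ u v = trans (cong parity (length-++ u)) (+-homo-+ (length u) (length v))

  ∼-parity : ∀ {u v} → u ∼ v → parity (length u) ≡ parity (length v)
  ∼-parity ∼-refl          = refl
  ∼-parity (∼-sym p)       = sym (∼-parity p)
  ∼-parity (∼-trans p q)   = trans (∼-parity p) (∼-parity q)
  ∼-parity (∼-rel u s t v) = begin
    parity (length (u ++ relator s t ++ v))                ≡⟨ parity-++ u (relator s t ++ v) ⟩
    parity (length u) +ℙ parity (length (relator s t ++ v)) ≡⟨ cong (parity (length u) +ℙ_) (parity-++ (relator s t) v) ⟩
    parity (length u) +ℙ (parity (length (relator s t)) +ℙ parity (length v))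
      ≡⟨ cong (λ p → parity (length u) +ℙ (p +ℙ parity (length v))) (parity-pairs s t (m s t)) ⟩
    parity (length u) +ℙ parity (length v)                 ≡⟨ sym (parity-++ u v) ⟩
    parity (length (u ++ v))                               ∎
    where open ≡-Reasoning

-- W = ⟨ S ∣ (st)^m(s,t) = 1 ⟩: the images of S generate W, the relations hold
-- in W, and every equality between words in W is a consequence of them.
record CoxeterSystem (a : Level) : Set (lsuc a) where
  field
    group : Group a a
    S     : Set a
    M     : CoxeterMatrix S
  open Group group public using (_≈_; _≉_; _∙_; ε; _⁻¹) renaming (Carrier to W)
  open Presentation M public using (relator; _∼_)
  field
    gen : S → W

  ⟦_⟧ : List S → W
  ⟦_⟧ = foldr (λ s w → gen s ∙ w) ε

  field
    generates : ∀ w → ∃ λ u → ⟦ u ⟧ ≈ w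
    relations : ∀ s t → ⟦ relator s t ⟧ ≈ ε
    presents  : ∀ u v → ⟦ u ⟧ ≈ ⟦ v ⟧ → u ∼ v

-- Excluded middle is the ambient logic; it makes ℓ and P^ J total functions for
-- arbitrary S and arbitrary J ⊆ S.
module Coxeter (em : ∀ {p} → ExcludedMiddle p) {a : Level} (C : CoxeterSystem a) where
  open CoxeterSystem C public
  private module G = Group group

  private
    minimalWord : ∀ w → ∃ λ n → (∃ λ u → ⟦ u ⟧ ≈ w × length u ≡ n)
                              × (∀ k → (∃ λ u → ⟦ u ⟧ ≈ w × length u ≡ k) → n ≤ k)
    minimalWord w = least (λ n → ∃ λ u → ⟦ u ⟧ ≈ w × length u ≡ n) (λ _ → em)
                          (length (proj₁ (generates w)))
                          (proj₁ (generates w) , proj₂ (generates w) , refl)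

  ℓ : W → ℕ
  ℓ w = proj₁ (minimalWord w)

  ℓ-reduced : ∀ w → ∃ λ u → ⟦ u ⟧ ≈ w × length u ≡ ℓ w
  ℓ-reduced w = proj₁ (proj₂ (minimalWord w))

  ℓ-minimal : ∀ w u → ⟦ u ⟧ ≈ w → ℓ w ≤ length u
  ℓ-minimal w u e = proj₂ (proj₂ (minimalWord w)) (length u) (u , e , refl)

  T : Pred W a
  T t = ∃₂ λ w s → t ≈ w ∙ gen s ∙ w ⁻¹

  BruhatStep : W → W → Set a
  BruhatStep u v = ∃ λ t → t ∈ T × v ≈ t ∙ u × ℓ u < ℓ v

  infix 4 _≤ᴮ_ _<ᴮ_

  _≤ᴮ_ : W → W → Set a
  u ≤ᴮ v = u ≈ v ⊎ TransClosure BruhatStep u v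

  _<ᴮ_ : W → W → Set a
  _<ᴮ_ = NonStrictToStrict._<_ _≈_ _≤ᴮ_

  -- Chain X u v: u < t₁u < ⋯ < tᵣ⋯t₁u = v with all tᵢ ∈ X.
  data Chain (X : Pred W a) : W → W → Set a where
    done : ∀ {u v} → u ≈ v → Chain X u v
    step : ∀ {u v} t → t ∈ X → u <ᴮ t ∙ u → Chain X (t ∙ u) v → Chain X u v

  infix 4 _≤L[_]_

  _≤L[_]_ : W → Pred W a → W → Set a
  u ≤L[ X ] v = u ≈ v ⊎ (ℓ u < ℓ v × Chain X u v)

  -- Reflections have odd length, so the division is exact.
  T[_] : ℕ → Pred W a
  T[ k ] t = t ∈ T × (ℓ t ∸ 1) / 2 ≤ k

  data ⟨_⟩ (A : Pred W a) : Pred W a where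
    gen⟨⟩ : ∀ {w} → w ∈ A → w ∈ ⟨ A ⟩
    ε⟨⟩   : ε ∈ ⟨ A ⟩
    ∙⟨⟩   : ∀ {v w} → v ∈ ⟨ A ⟩ → w ∈ ⟨ A ⟩ → v ∙ w ∈ ⟨ A ⟩
    ⁻¹⟨⟩  : ∀ {w} → w ∈ ⟨ A ⟩ → w ⁻¹ ∈ ⟨ A ⟩
    ≈⟨⟩   : ∀ {v w} → v ≈ w → v ∈ ⟨ A ⟩ → w ∈ ⟨ A ⟩

  IsReflectionSubgroup : Pred W a → Set (lsuc a)
  IsReflectionSubgroup W′ = Σ (Pred W a) λ A → A ⊆ T × W′ ≐ ⟨ A ⟩

  N : W → Pred W a
  N v t = t ∈ T × ℓ (t ∙ v) < ℓ v

  CanonicalGenerators : Pred W a → Pred W a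
  CanonicalGenerators W′ t = t ∈ T × (N t ∩ W′) ≐ (_≈ t)

  IsDihedral : Pred W a → Set a
  IsDihedral W′ = ∃₂ λ r r′ → r ≉ r′ × CanonicalGenerators W′ ≐ (λ t → t ≈ r ⊎ t ≈ r′)

  Ω : W → W → Set a
  Ω u v = u ∙ v ⁻¹ ∈ T × u <ᴮ v

  -- Walk Y n u v: a directed path with n arrows in the induced subgraph Ω(Y).
  data Walk (Y : Pred W a) : ℕ → W → W → Set a where
    stop : ∀ {u v} → u ∈ Y → v ∈ Y → u ≈ v → Walk Y 0 u v
    move : ∀ {n u v w} → u ∈ Y → v ∈ Y → Ω u v → Walk Y n v w → Walk Y (suc n) u w

  -- The directed distance is the infimum of the lengths of directed paths.
  FiniteDistance : Pred W a → W → W → Set a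
  FiniteDistance Y u v = ∃ λ n → Walk Y n u v

  infix 4 _⊑′_ _⊑_

  _⊑′_ : W → W → Set (lsuc a)
  t ⊑′ t′ = t ∈ T × t′ ∈ T ×
    (t ≈ t′ ⊎ Σ (Pred W a) λ W′ → IsReflectionSubgroup W′ × IsDihedral W′ ×
                                  t ∈ W′ × t′ ∈ W′ × FiniteDistance W′ t t′)

  _⊑_ : W → W → Set (lsuc a)
  _⊑_ = TransClosure _⊑′_

  -- Compatibility of X with ≈ follows from downward closure, as ⊑ contains ≈ on T.
  record IsOrderIdeal (X : Pred W a) : Set (lsuc a) where
    field
      X⊆T    : X ⊆ T
      closed : ∀ {t t′} → t ⊑ t′ → t′ ∈ X → t ∈ X

  W[_] : Pred S a → Pred W a
  W[ J ] = ⟨ (λ w → ∃ λ s → s ∈ J × w ≈ gen s) ⟩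

  W^[_] : Pred S a → Pred W a
  W^[ J ] w = ∀ s → s ∈ J → ℓ w < ℓ (w ∙ gen s)

  record Factorisation (J : Pred S a) (w : W) : Set a where
    field
      w^J      : W
      w_J      : W
      w^J∈W^J  : w^J ∈ W^[ J ]
      w_J∈W_J  : w_J ∈ W[ J ]
      product  : w ≈ w^J ∙ w_J
      additive : ℓ w ≡ ℓ w^J + ℓ w_J

  private
    ⟦++⟧ : ∀ u v → ⟦ u ++ v ⟧ ≈ ⟦ u ⟧ ∙ ⟦ v ⟧
    ⟦++⟧ []      v = G.sym (G.identityˡ _)
    ⟦++⟧ (s ∷ u) v = G.trans (G.∙-congˡ (⟦++⟧ u v)) (G.sym (G.assoc _ _ _))

    ⟦s⟧ : ∀ s → ⟦ s ∷ [] ⟧ ≈ gen s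
    ⟦s⟧ s = G.identityʳ _

    gen² : ∀ s → gen s ∙ gen s ≈ ε
    gen² s = G.trans (G.∙-congˡ (G.sym (⟦s⟧ s))) (subst (λ n → ⟦ concat (replicate n (s ∷ s ∷ [])) ⟧ ≈ ε)
                     (CoxeterMatrix.diagonal M s) (relations s s))

    ∙gen-gen : ∀ w s → w ∙ gen s ∙ gen s ≈ w
    ∙gen-gen w s = G.trans (G.assoc _ _ _) (G.trans (G.∙-congˡ (gen² s)) (G.identityʳ w))

    ℓ-∙ : ∀ v w x → x ≈ v ∙ w → ℓ x ≤ ℓ v + ℓ w
    ℓ-∙ v w x e with ℓ-reduced v | ℓ-reduced w
    ... | p , ep , lp | q , eq , lq = ≤-trans
      (ℓ-minimal x (p ++ q) (G.trans (⟦++⟧ p q) (G.trans (G.∙-cong ep eq) (G.sym e))))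
      (≤-reflexive (trans (length-++ p) (cong₂ _+_ lp lq)))

    ℓ-gen : ∀ s → ℓ (gen s) ≤ 1
    ℓ-gen s = ℓ-minimal (gen s) (s ∷ []) (⟦s⟧ s)

    ℓ-∙gen : ∀ w s x → x ≈ w ∙ gen s → ℓ x ≤ ℓ w + 1
    ℓ-∙gen w s x e = ≤-trans (ℓ-∙ w (gen s) x e) (+-monoʳ-≤ (ℓ w) (ℓ-gen s))

    ℓ-parity : ∀ w s → ℓ w ≢ ℓ (w ∙ gen s)
    ℓ-parity w s eq with ℓ-reduced w | ℓ-reduced (w ∙ gen s)
    ... | p , ep , lp | q , eq′ , lq = p≢p⁻¹ (parity (suc (ℓ w))) (begin
      parity (suc (ℓ w))              ≡⟨ cong (parity ∘ suc) lp ⟨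
      parity (suc (length p))         ≡⟨ cong parity (+-comm 1 (length p)) ⟩
      parity (length p + 1)           ≡⟨ cong parity (length-++ p) ⟨
      parity (length (p ++ s ∷ []))   ≡⟨ Presentation.∼-parity M {p ++ s ∷ []} {q} (presents (p ++ s ∷ []) q words) ⟩
      parity (length q)               ≡⟨ cong parity (trans lq (sym eq)) ⟩
      parity (ℓ w)                    ≡⟨ suc-homo-⁻¹ (ℓ w) ⟨
      parity (suc (ℓ w)) ⁻¹ℙ     ∎)
      where
      open ≡-Reasoning
      words : ⟦ p ++ s ∷ [] ⟧ ≈ ⟦ q ⟧
      words = G.trans (⟦++⟧ p (s ∷ [])) (G.trans (G.∙-cong ep (⟦s⟧ s)) (G.sym eq′))

    factorise : ∀ J w → Acc _<_ (ℓ w) → Factorisation J w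
    factorise J w (acc rec) with em {P = ∃ λ s → s ∈ J × ℓ (w ∙ gen s) < ℓ w}
    ... | no ¬desc = record
      { w^J = w ; w_J = ε
      ; w^J∈W^J = λ s s∈J → ≤∧≢⇒< (≮⇒≥ λ lt → ¬desc (s , s∈J , lt)) (ℓ-parity w s)
      ; w_J∈W_J = ε⟨⟩
      ; product = G.sym (G.identityʳ w)
      ; additive = sym (trans (cong (ℓ w +_) (≤-antisym (ℓ-minimal ε [] G.refl) z≤n)) (+-identityʳ (ℓ w)))
      }
    ... | yes (s , s∈J , lt) = record
      { w^J = F.w^J ; w_J = F.w_J ∙ gen s
      ; w^J∈W^J = F.w^J∈W^J
      ; w_J∈W_J = ∙⟨⟩ F.w_J∈W_J (gen⟨⟩ (s , s∈J , G.refl))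
      ; product = prod
      ; additive = ≤-antisym (ℓ-∙ F.w^J (F.w_J ∙ gen s) w prod) (begin
          ℓ F.w^J + ℓ (F.w_J ∙ gen s)  ≤⟨ +-monoʳ-≤ (ℓ F.w^J) (ℓ-∙gen F.w_J s _ G.refl) ⟩
          ℓ F.w^J + (ℓ F.w_J + 1)      ≡⟨ +-assoc (ℓ F.w^J) (ℓ F.w_J) 1 ⟨
          ℓ F.w^J + ℓ F.w_J + 1        ≡⟨ cong (_+ 1) F.additive ⟨
          ℓ (w ∙ gen s) + 1            ≡⟨ +-comm (ℓ (w ∙ gen s)) 1 ⟩
          suc (ℓ (w ∙ gen s))          ≤⟨ lt ⟩
          ℓ w                          ∎)
      }
      where
      open ≤-Reasoning
      module F = Factorisation (factorise J (w ∙ gen s) (rec lt))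
      prod : w ≈ F.w^J ∙ (F.w_J ∙ gen s)
      prod = G.trans (G.sym (∙gen-gen w s)) (G.trans (G.∙-congʳ F.product) (G.assoc _ _ _))

  factorisation : ∀ J w → Factorisation J w
  factorisation J w = factorise J w (<-wellFounded (ℓ w))

  P^ : Pred S a → W → W
  P^ J w = Factorisation.w^J (factorisation J w)

{-# OPTIONS --safe #-}
module Submission where

open import Axiom.ExcludedMiddle using (ExcludedMiddle)
open import Data.Nat.Base using (ℕ)
open import Data.Product.Base using (_×_)
open import Level using (Level)
open import Relation.Unary using (Pred)
open import Defs
open import Algebra.Bundles using (Group)
open import Data.Bool.Base using (Bool; true; false; not; _xor_)
open import Data.Bool.Properties using (xor-assoc; xor-same; xor-identityʳ; ¬-not)
open import Data.Fin.Base using (Fin)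
open import Data.Fin.Patterns using (0F; 1F; 2F; 3F)
import Data.Fin.Properties as Fin
open import Data.List.Base using (List; []; _∷_; _++_; length; concat; replicate)
open import Data.List.Properties using (length-++)
open import Data.List.Relation.Unary.All using (All; []; _∷_)
open import Data.List.Relation.Unary.All.Properties using (++⁺)
open import Data.Maybe.Base using (Maybe; just; nothing)
open import Data.Nat.Base using (zero; suc; _+_; _≤_; _<_; s≤s; parity)
open import Data.Nat.DivMod using (/-monoˡ-≤)
open import Data.Nat.Induction using (<-wellFounded)
open import Data.Nat.Properties using (+-suc; +-monoˡ-<; +-monoʳ-<; ∸-monoˡ-≤; ≤-refl; ≤-reflexive; ≤-trans; ≤-antisym; <-trans; <-irrefl; <-asym; <⇒≤; <⇒≱; ≮⇒≥)
open import Data.Parity.Base using (Parity; 0ℙ; 1ℙ) renaming (_+_ to _+ℙ_)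
open import Data.Parity.Properties using (+-homo-+)
open import Data.Product.Base using (Σ; ∃; ∃₂; _,_; proj₁; proj₂)
open import Data.Sum.Base using (_⊎_; inj₁; inj₂; swap)
open import Data.Vec.Base using (Vec; []; _∷_; lookup)
open import Function.Base using (_∘_; _$_)
open import Function.Bundles using (mk⇔)
open import Induction.WellFounded using (Acc; acc)
open import Relation.Binary.Construct.Closure.Transitive using (TransClosure; [_]; _∷_)
open import Relation.Binary.PropositionalEquality using (_≡_; refl; sym; trans; cong; cong₂; subst; subst₂; module ≡-Reasoning)
open import Relation.Nullary.Decidable using (yes; no; does; dec-true; dec-false; does-⇔; toSum)
open import Relation.Nullary.Negation.Core using (¬_; contradiction)
open import Relation.Unary using (_∈_; _⊆_)

-- Let u < tu with t ∈ X; induct on (ℓ(t), ℓ(tu)).  If s ∈ J is a right descent of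
-- tu, then either tu = us or us < tus, and the pair (us, tus) has the same
-- projections.  If neither u nor tu has a right descent in J, both are fixed by P^J.
-- Otherwise some s ∈ J is a right descent of u but not of tu.  In the coset W′u of
-- the dihedral group W′ = ⟨t, usu⁻¹⟩ the elements z with z < zs form a chain under
-- left multiplication by the two canonical generators of W′, so one climbs from us
-- to tu by canonical generators c.  As t is not canonical, each c satisfies c ⊑ t
-- and ℓ(c) < ℓ(t), so the induction hypothesis applies to every step.
-- All facts on W′ come from the cocycle N(vw) = N(v) + vN(w)v⁻¹ (symmetric difference).

-- The obstacle is the mixed case: `P^ J` identifies u with us but fixes tu, and us and tu differ by
-- an even element, so no single reflection joins them. They do lie in one coset of W′, because us =
-- (usu⁻¹)u. For every z in that coset zsz⁻¹ is a conjugate of usu⁻¹ inside W′, so whether z < zs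
-- can be followed by looking at W′ alone. Why these z form a chain: removing a canonical descent
-- keeps z < zs, so each z is linked to the bottom of the coset. Going up there is no choice, since
-- one of the two canonical generators is ruled out: it is a descent of z, or z is the bottom and it
-- equals zsz⁻¹ and leads to zs, which is not of this kind. Hence us and tu are comparable, and
-- their lengths fix the direction. The order of W′, finite or infinite, never enters. The climb
-- ends in tu itself, so its last step does not lower ℓ(tu); this is why ℓ(t) has to come first in
-- the induction.

-- Free reduction decides equalities between group words in which some of the
-- variables (`inv`) stand for involutions.
module InvolutiveSolver {c ℓ} (G : Group c ℓ) where
  open Group G renaming (refl to ≈-refl; sym to ≈-sym; trans to ≈-trans)
  open import Algebra.Properties.Group G using (⁻¹-involutive; ⁻¹-anti-homo-∙; ε⁻¹≈ε; inverseʳ-unique)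
  open import Relation.Binary.Reasoning.Setoid setoid

  Involution : Set _
  Involution = Σ Carrier λ x → x ∙ x ≈ ε

  infixl 7 _⊙_
  infix 8 _⁻

  data Expr (m n : ℕ) : Set where
    inv : Fin m → Expr m n
    var : Fin n → Expr m n
    one : Expr m n
    _⊙_ : Expr m n → Expr m n → Expr m n
    _⁻  : Expr m n → Expr m n

  data Letter (m n : ℕ) : Set where
    inv     : Fin m → Letter m n
    pos neg : Fin n → Letter m n

  module _ {m n : ℕ} where

    opposite : Letter m n → Letter m n
    opposite (inv i) = inv i
    opposite (pos i) = neg i
    opposite (neg i) = pos i

    opposite? : (x y : Letter m n) → Maybe (y ≡ opposite x)
    opposite? (inv i) (inv j) with i Fin.≟ j
    ... | yes refl = just refl
    ... | no _     = nothing
    opposite? (pos i) (neg j) with i Fin.≟ j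
    ... | yes refl = just refl
    ... | no _     = nothing
    opposite? (neg i) (pos j) with i Fin.≟ j
    ... | yes refl = just refl
    ... | no _     = nothing
    opposite? _ _ = nothing

    push : Letter m n → List (Letter m n) → List (Letter m n)
    push x []      = x ∷ []
    push x (y ∷ w) with opposite? x y
    ... | just _  = w
    ... | nothing = x ∷ y ∷ w

    pushExpr pushInverse : Expr m n → List (Letter m n) → List (Letter m n)
    pushExpr (inv i) = push (inv i)
    pushExpr (var i) = push (pos i)
    pushExpr one     w = w
    pushExpr (e ⊙ f) w = pushExpr e (pushExpr f w)
    pushExpr (e ⁻)     = pushInverse e
    pushInverse (inv i) = push (inv i)
    pushInverse (var i) = push (neg i)
    pushInverse one     w = w
    pushInverse (e ⊙ f) w = pushInverse f (pushInverse e w)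
    pushInverse (e ⁻)     = pushExpr e

    module _ (xs : Vec Involution m) (ys : Vec Carrier n) where

      ⟦_⟧ₑ : Expr m n → Carrier
      ⟦ inv i ⟧ₑ = proj₁ (lookup xs i)
      ⟦ var i ⟧ₑ = lookup ys i
      ⟦ one   ⟧ₑ = ε
      ⟦ e ⊙ f ⟧ₑ = ⟦ e ⟧ₑ ∙ ⟦ f ⟧ₑ
      ⟦ e ⁻   ⟧ₑ = ⟦ e ⟧ₑ ⁻¹

      letter : Letter m n → Carrier
      letter (inv i) = proj₁ (lookup xs i)
      letter (pos i) = lookup ys i
      letter (neg i) = lookup ys i ⁻¹

      word : List (Letter m n) → Carrier
      word []      = ε
      word (x ∷ w) = letter x ∙ word w

      letter-opposite : ∀ x → letter x ∙ letter (opposite x) ≈ ε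
      letter-opposite (inv i) = proj₂ (lookup xs i)
      letter-opposite (pos i) = inverseʳ _
      letter-opposite (neg i) = inverseˡ _

      push-sound : ∀ x w → word (push x w) ≈ letter x ∙ word w
      push-sound x []      = ≈-refl
      push-sound x (y ∷ w) with opposite? x y
      ... | nothing   = ≈-refl
      ... | just refl = begin
        word w                                         ≈⟨ identityˡ _ ⟨
        ε ∙ word w                                     ≈⟨ ∙-congʳ (letter-opposite x) ⟨
        letter x ∙ letter (opposite x) ∙ word w        ≈⟨ assoc _ _ _ ⟩
        letter x ∙ (letter (opposite x) ∙ word w)      ∎

      pushExpr-sound : ∀ e w → word (pushExpr e w) ≈ ⟦ e ⟧ₑ ∙ word w
      pushInverse-sound : ∀ e w → word (pushInverse e w) ≈ ⟦ e ⟧ₑ ⁻¹ ∙ word w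
      pushExpr-sound (inv i) w = push-sound (inv i) w
      pushExpr-sound (var i) w = push-sound (pos i) w
      pushExpr-sound one     w = ≈-sym (identityˡ _)
      pushExpr-sound (e ⊙ f) w = begin
        word (pushExpr e (pushExpr f w)) ≈⟨ pushExpr-sound e _ ⟩
        ⟦ e ⟧ₑ ∙ word (pushExpr f w)     ≈⟨ ∙-congˡ (pushExpr-sound f w) ⟩
        ⟦ e ⟧ₑ ∙ (⟦ f ⟧ₑ ∙ word w)       ≈⟨ assoc _ _ _ ⟨
        ⟦ e ⟧ₑ ∙ ⟦ f ⟧ₑ ∙ word w         ∎
      pushExpr-sound (e ⁻)   w = pushInverse-sound e w
      pushInverse-sound (inv i) w = ≈-trans (push-sound (inv i) w) (∙-congʳ (inverseʳ-unique _ _ (proj₂ (lookup xs i))))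
      pushInverse-sound (var i) w = push-sound (neg i) w
      pushInverse-sound one     w = ≈-sym (≈-trans (∙-congʳ ε⁻¹≈ε) (identityˡ _))
      pushInverse-sound (e ⊙ f) w = begin
        word (pushInverse f (pushInverse e w)) ≈⟨ pushInverse-sound f _ ⟩
        ⟦ f ⟧ₑ ⁻¹ ∙ word (pushInverse e w)     ≈⟨ ∙-congˡ (pushInverse-sound e w) ⟩
        ⟦ f ⟧ₑ ⁻¹ ∙ (⟦ e ⟧ₑ ⁻¹ ∙ word w)       ≈⟨ assoc _ _ _ ⟨
        ⟦ f ⟧ₑ ⁻¹ ∙ ⟦ e ⟧ₑ ⁻¹ ∙ word w         ≈⟨ ∙-congʳ (⁻¹-anti-homo-∙ _ _) ⟨
        (⟦ e ⟧ₑ ∙ ⟦ f ⟧ₑ) ⁻¹ ∙ word w          ∎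
      pushInverse-sound (e ⁻)   w = ≈-trans (pushExpr-sound e w) (∙-congʳ (≈-sym (⁻¹-involutive _)))

      solve : ∀ e f → pushExpr e [] ≡ pushExpr f [] → ⟦ e ⟧ₑ ≈ ⟦ f ⟧ₑ
      solve e f eq = begin
        ⟦ e ⟧ₑ              ≈⟨ identityʳ _ ⟨
        ⟦ e ⟧ₑ ∙ ε          ≈⟨ pushExpr-sound e [] ⟨
        word (pushExpr e []) ≡⟨ cong word eq ⟩
        word (pushExpr f []) ≈⟨ pushExpr-sound f [] ⟩
        ⟦ f ⟧ₑ ∙ ε          ≈⟨ identityʳ _ ⟩
        ⟦ f ⟧ₑ              ∎

module CoxeterProperties (em : ∀ {p} → ExcludedMiddle p) {a : Level} (C : CoxeterSystem a) where
  open Coxeter em C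
  private module G = Group group
  open import Algebra.Properties.Group group using (∙-cancelˡ; ⁻¹-anti-homo-∙; x∙y⁻¹≈ε⇒x≈y)
  open InvolutiveSolver group using (Involution; inv; var; one; _⊙_; _⁻; solve)

  -- The reflection cocycle

  ⟦++⟧ : ∀ u v → ⟦ u ++ v ⟧ ≈ ⟦ u ⟧ ∙ ⟦ v ⟧
  ⟦++⟧ []      v = G.sym (G.identityˡ _)
  ⟦++⟧ (s ∷ u) v = G.trans (G.∙-congˡ (⟦++⟧ u v)) (G.sym (G.assoc _ _ _))

  gen² : ∀ s → gen s ∙ gen s ≈ ε
  gen² s = G.trans (G.∙-congˡ (G.sym (G.identityʳ _))) (subst (λ n → ⟦ concat (replicate n (s ∷ s ∷ [])) ⟧ ≈ ε)
                   (CoxeterMatrix.diagonal M s) (relations s s))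

  genᵢ : S → Involution
  genᵢ s = gen s , gen² s

  ℓ-cong : ∀ {v w} → v ≈ w → ℓ v ≡ ℓ w
  ℓ-cong v≈w = ≤-antisym (ℓ-≤ v≈w) (ℓ-≤ (G.sym v≈w))
    where
    ℓ-≤ : ∀ {v w} → v ≈ w → ℓ v ≤ ℓ w
    ℓ-≤ {v} {w} v≈w with ℓ-reduced w
    ... | u , ⟦u⟧≈w , eq = subst (ℓ v ≤_) eq (ℓ-minimal v u (G.trans ⟦u⟧≈w (G.sym v≈w)))

  infixl 7.5 _^_
  _^_ : W → W → W
  t ^ w = w ⁻¹ ∙ t ∙ w

  ^-cong : ∀ {t t′ w w′} → t ≈ t′ → w ≈ w′ → t ^ w ≈ t′ ^ w′
  ^-cong t≈t′ w≈w′ = G.∙-cong (G.∙-cong (G.⁻¹-cong w≈w′) t≈t′) w≈w′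

  ^-ε : ∀ t → t ^ ε ≈ t
  ^-ε t = solve [] (t ∷ []) (one ⁻ ⊙ var 0F ⊙ one) (var 0F) refl

  ^-∙ : ∀ t v w → t ^ (v ∙ w) ≈ (t ^ v) ^ w
  ^-∙ t v w = solve [] (t ∷ v ∷ w ∷ [])
    ((var 1F ⊙ var 2F) ⁻ ⊙ var 0F ⊙ (var 1F ⊙ var 2F)) (var 2F ⁻ ⊙ (var 1F ⁻ ⊙ var 0F ⊙ var 1F) ⊙ var 2F) refl

  ^≈⇒≈ : ∀ {t x} w → t ^ w ≈ x → t ≈ w ∙ x ∙ w ⁻¹
  ^≈⇒≈ {t} {x} w eq = G.trans
    (solve [] (t ∷ w ∷ []) (var 0F) (var 1F ⊙ (var 1F ⁻ ⊙ var 0F ⊙ var 1F) ⊙ var 1F ⁻) refl)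
    (G.∙-congʳ (G.∙-congˡ eq))

  ≈⇒^≈ : ∀ {t x} w → t ≈ w ∙ x ∙ w ⁻¹ → t ^ w ≈ x
  ≈⇒^≈ {t} {x} w eq = G.trans (^-cong eq G.refl)
    (solve [] (x ∷ w ∷ []) (var 1F ⁻ ⊙ (var 1F ⊙ var 0F ⊙ var 1F ⁻) ⊙ var 1F) (var 0F) refl)

  _≟_ : W → W → Bool
  x ≟ y = does (em {P = x ≈ y})

  ≟-true : ∀ {x y} → x ≈ y → (x ≟ y) ≡ true
  ≟-true = dec-true em

  ≟-false : ∀ {x y} → x ≉ y → (x ≟ y) ≡ false
  ≟-false = dec-false em

  ≟-⇔ : ∀ {x y x′ y′} → (x ≈ y → x′ ≈ y′) → (x′ ≈ y′ → x ≈ y) → (x ≟ y) ≡ (x′ ≟ y′)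
  ≟-⇔ f g = does-⇔ (mk⇔ f g) em em

  ≟-cong : ∀ {x y x′ y′} → x ≈ x′ → y ≈ y′ → (x ≟ y) ≡ (x′ ≟ y′)
  ≟-cong p q = ≟-⇔ (λ e → G.trans (G.sym p) (G.trans e q)) (λ e → G.trans p (G.trans e (G.sym q)))

  ≟-sound : ∀ {x y} → (x ≟ y) ≡ true → x ≈ y
  ≟-sound {x} {y} eq with em {P = x ≈ y}
  ≟-sound eq | yes p = p
  ≟-sound () | no _

  -- count u t is the parity of the number of occurrences of t in the sequence
  -- s₁, s₁s₂s₁, s₁s₂s₃s₂s₁, … of the word u = s₁s₂s₃⋯.
  count : List S → W → Bool
  count []      t = false
  count (s ∷ u) t = (t ≟ gen s) xor count u (t ^ gen s)

  count-cong : ∀ u {t t′} → t ≈ t′ → count u t ≡ count u t′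
  count-cong []      eq = refl
  count-cong (s ∷ u) eq = cong₂ _xor_ (≟-cong eq G.refl) (count-cong u (^-cong eq G.refl))

  -- The cocycle identity at the level of words: a prefix u conjugates every reflection contributed
  -- by v.
  count-++ : ∀ u v t → count (u ++ v) t ≡ count u t xor count v (t ^ ⟦ u ⟧)
  count-++ []      v t = count-cong v (G.sym (^-ε t))
  count-++ (s ∷ u) v t = begin
    (t ≟ gen s) xor count (u ++ v) (t ^ gen s)
      ≡⟨ cong ((t ≟ gen s) xor_) (count-++ u v _) ⟩
    (t ≟ gen s) xor (count u (t ^ gen s) xor count v ((t ^ gen s) ^ ⟦ u ⟧))
      ≡⟨ xor-assoc (t ≟ gen s) _ _ ⟨
    count (s ∷ u) t xor count v ((t ^ gen s) ^ ⟦ u ⟧)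
      ≡⟨ cong (count (s ∷ u) t xor_) (count-cong v (^-∙ t (gen s) ⟦ u ⟧)) ⟨
    count (s ∷ u) t xor count v (t ^ ⟦ s ∷ u ⟧) ∎
    where open ≡-Reasoning

  ⨁ : (ℕ → Bool) → ℕ → Bool
  ⨁ f zero    = false
  ⨁ f (suc n) = f 0 xor ⨁ (f ∘ suc) n

  ⨁-cong : ∀ {f g} → (∀ k → f k ≡ g k) → ∀ n → ⨁ f n ≡ ⨁ g n
  ⨁-cong f≗g zero    = refl
  ⨁-cong f≗g (suc n) = cong₂ _xor_ (f≗g 0) (⨁-cong (f≗g ∘ suc) n)

  ⨁-+ : ∀ f m n → ⨁ f (m + n) ≡ ⨁ f m xor ⨁ (f ∘ (m +_)) n
  ⨁-+ f zero    n = refl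
  ⨁-+ f (suc m) n = trans (cong (f 0 xor_) (⨁-+ (f ∘ suc) m n)) (sym (xor-assoc (f 0) _ _))

  -- The sequence of the relator (sr)ᵐ consists of the (sr)ᵏs with k < 2m; it has
  -- period m, so every reflection occurs in it an even number of times.
  module Relator (s r : S) where
    pairs : ℕ → List S
    pairs n = concat (replicate n (s ∷ r ∷ []))

    reflection : ℕ → W
    reflection zero    = gen s
    reflection (suc k) = gen s ∙ gen r ∙ reflection k

    reflection-conj : ∀ k → gen s ∙ gen r ∙ reflection k ∙ (gen s ∙ gen r) ⁻¹ ≈ reflection (2 + k)
    reflection-conj zero    = solve (genᵢ s ∷ genᵢ r ∷ []) []
      (inv 0F ⊙ inv 1F ⊙ inv 0F ⊙ (inv 0F ⊙ inv 1F) ⁻) (inv 0F ⊙ inv 1F ⊙ (inv 0F ⊙ inv 1F ⊙ inv 0F)) refl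
    reflection-conj (suc k) = G.trans
      (solve [] (d ∷ reflection k ∷ []) (var 0F ⊙ (var 0F ⊙ var 1F) ⊙ var 0F ⁻) (var 0F ⊙ (var 0F ⊙ var 1F ⊙ var 0F ⁻)) refl)
      (G.∙-congˡ (reflection-conj k))
      where d = gen s ∙ gen r

    reflection-+ : ∀ m k → ⟦ pairs m ⟧ ∙ reflection k ≈ reflection (m + k)
    reflection-+ zero    k = G.identityˡ _
    reflection-+ (suc m) k = G.trans
      (solve [] (gen s ∷ gen r ∷ ⟦ pairs m ⟧ ∷ reflection k ∷ [])
        (var 0F ⊙ (var 1F ⊙ var 2F) ⊙ var 3F) (var 0F ⊙ var 1F ⊙ (var 2F ⊙ var 3F)) refl)
      (G.∙-congˡ (reflection-+ m k))

    -- One pair of letters contributes the terms 0 and 1, and conjugation by `gen s ∙ gen r` shifts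
    -- the index of every later term by 2.
    count-pairs : ∀ n t → count (pairs n) t ≡ ⨁ (λ k → t ≟ reflection k) (n + n)
    count-pairs zero    t = refl
    count-pairs (suc n) t rewrite +-suc n n = cong ((t ≟ gen s) xor_) $ cong₂ _xor_
      (≟-⇔ (λ e → G.trans (^≈⇒≈ (gen s) e) srs) (λ e → ≈⇒^≈ (gen s) (G.trans e (G.sym srs))))
      (begin
        count (pairs n) (t ^ gen s ^ gen r)                  ≡⟨ count-cong (pairs n) (^-∙ t (gen s) (gen r)) ⟨
        count (pairs n) (t ^ d)                              ≡⟨ count-pairs n _ ⟩
        ⨁ (λ k → (t ^ d) ≟ reflection k) (n + n)             ≡⟨ ⨁-cong shift (n + n) ⟩
        ⨁ (λ k → t ≟ reflection (2 + k)) (n + n)             ∎)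
      where
      open ≡-Reasoning
      d = gen s ∙ gen r
      srs : gen s ∙ gen r ∙ gen s ⁻¹ ≈ reflection 1
      srs = solve (genᵢ s ∷ genᵢ r ∷ []) [] (inv 0F ⊙ inv 1F ⊙ inv 0F ⁻) (inv 0F ⊙ inv 1F ⊙ inv 0F) refl
      shift : ∀ k → ((t ^ d) ≟ reflection k) ≡ (t ≟ reflection (2 + k))
      shift k = ≟-⇔ (λ e → G.trans (^≈⇒≈ d e) (reflection-conj k))
                    (λ e → ≈⇒^≈ d (G.trans e (G.sym (reflection-conj k))))

    count-relator : ∀ t → count (relator s r) t ≡ false
    count-relator t = begin
      count (pairs m) t                  ≡⟨ count-pairs m t ⟩
      ⨁ f (m + m)                        ≡⟨ ⨁-+ f m m ⟩
      ⨁ f m xor ⨁ (f ∘ (m +_)) m         ≡⟨ cong (⨁ f m xor_) (⨁-cong periodic m) ⟩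
      ⨁ f m xor ⨁ f m                    ≡⟨ xor-same (⨁ f m) ⟩
      false                              ∎
      where
      open ≡-Reasoning
      m = CoxeterMatrix.m M s r
      f : ℕ → Bool
      f k = t ≟ reflection k
      periodic : ∀ k → f (m + k) ≡ f k
      periodic k = ≟-cong G.refl (G.trans (G.sym (reflection-+ m k)) (G.trans (G.∙-congʳ (relations s r)) (G.identityˡ _)))

  -- Inserting a relator changes nothing for two reasons: its own count vanishes, and it represents
  -- ε, so the tail is conjugated trivially.
  count-∼ : ∀ {u v} → u ∼ v → ∀ t → count u t ≡ count v t
  count-∼ Presentation.∼-refl          t = refl
  count-∼ (Presentation.∼-sym p)       t = sym (count-∼ p t)
  count-∼ (Presentation.∼-trans p q)   t = trans (count-∼ p t) (count-∼ q t)
  count-∼ (Presentation.∼-rel u s r v) t = begin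
    count (u ++ relator s r ++ v) t                          ≡⟨ count-++ u _ t ⟩
    count u t xor count (relator s r ++ v) t′                ≡⟨ cong (count u t xor_) (count-++ (relator s r) v t′) ⟩
    count u t xor (count (relator s r) t′ xor count v (t′ ^ ⟦ relator s r ⟧))
      ≡⟨ cong (count u t xor_) (cong₂ _xor_ (Relator.count-relator s r t′)
           (count-cong v (G.trans (^-cong G.refl (relations s r)) (^-ε t′)))) ⟩
    count u t xor count v t′                                 ≡⟨ count-++ u v t ⟨
    count (u ++ v) t                                         ∎
    where
    open ≡-Reasoning
    t′ = t ^ ⟦ u ⟧

  -- The characteristic function of N(w), with xor as symmetric difference. It is read off an
  -- arbitrary word for w, which need not be reduced.
  η : W → W → Bool
  η w = count (proj₁ (generates w))

  η-word : ∀ u {w} → ⟦ u ⟧ ≈ w → ∀ t → η w t ≡ count u t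
  η-word u {w} eq = count-∼ (presents (proj₁ (generates w)) u (G.trans (proj₂ (generates w)) (G.sym eq)))

  η-cong : ∀ {v w t t′} → v ≈ w → t ≈ t′ → η v t ≡ η w t′
  η-cong {v} {w} {t} v≈w t≈t′ = trans
    (η-word (proj₁ (generates w)) (G.trans (proj₂ (generates w)) (G.sym v≈w)) t) (count-cong (proj₁ (generates w)) t≈t′)

  η-∙ : ∀ v w t → η (v ∙ w) t ≡ η v t xor η w (t ^ v)
  η-∙ v w t with generates v | generates w
  ... | p , p≈v | q , q≈w = begin
    η (v ∙ w) t                          ≡⟨ η-word (p ++ q) (G.trans (⟦++⟧ p q) (G.∙-cong p≈v q≈w)) t ⟩
    count (p ++ q) t                     ≡⟨ count-++ p q t ⟩
    count p t xor count q (t ^ ⟦ p ⟧)    ≡⟨ cong (count p t xor_) (count-cong q (^-cong G.refl p≈v)) ⟩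
    count p t xor count q (t ^ v)        ∎
    where open ≡-Reasoning

  η-ε : ∀ t → η ε t ≡ false
  η-ε = η-word [] G.refl

  η-gen : ∀ s t → η (gen s) t ≡ (t ≟ gen s)
  η-gen s t = trans (η-word (s ∷ []) (G.identityʳ _) t) (xor-identityʳ _)

  η-⁻¹ : ∀ w t → η (w ⁻¹) t ≡ η w (t ^ w ⁻¹)
  η-⁻¹ w t = xor-false (begin
    η w (t ^ w ⁻¹) xor η (w ⁻¹) t                ≡⟨ cong (η w (t ^ w ⁻¹) xor_) (η-cong G.refl conj-inverse) ⟩
    η w (t ^ w ⁻¹) xor η (w ⁻¹) (t ^ w ⁻¹ ^ w)   ≡⟨ η-∙ w (w ⁻¹) (t ^ w ⁻¹) ⟨
    η (w ∙ w ⁻¹) (t ^ w ⁻¹)                      ≡⟨ η-cong (G.inverseʳ w) G.refl ⟩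
    η ε (t ^ w ⁻¹)                               ≡⟨ η-ε _ ⟩
    false                                        ∎)
    where
    open ≡-Reasoning
    conj-inverse : t ≈ t ^ w ⁻¹ ^ w
    conj-inverse = solve [] (t ∷ w ∷ []) (var 0F) (var 1F ⁻ ⊙ (var 1F ⁻ ⁻ ⊙ var 0F ⊙ var 1F ⁻) ⊙ var 1F) refl
    xor-false : ∀ {b c} → b xor c ≡ false → c ≡ b
    xor-false {false} {false} _ = refl
    xor-false {true}  {true}  _ = refl

  -- Reflections, strong exchange, and the identification of `η` with N

  T-resp : ∀ {t t′} → t ≈ t′ → t ∈ T → t′ ∈ T
  T-resp t≈t′ (w , s , eq) = w , s , G.trans (G.sym t≈t′) eq

  gen∈T : ∀ s → gen s ∈ T
  gen∈T s = ε , s , solve [] (gen s ∷ []) (var 0F) (one ⊙ var 0F ⊙ one ⁻) refl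

  T-conj : ∀ {t} w → t ∈ T → w ∙ t ∙ w ⁻¹ ∈ T
  T-conj {t} w (z , s , eq) = w ∙ z , s , G.trans (G.∙-congʳ (G.∙-congˡ eq))
    (solve [] (w ∷ z ∷ gen s ∷ []) (var 0F ⊙ (var 1F ⊙ var 2F ⊙ var 1F ⁻) ⊙ var 0F ⁻)
      (var 0F ⊙ var 1F ⊙ var 2F ⊙ (var 0F ⊙ var 1F) ⁻) refl)

  T-^ : ∀ {t} w → t ^ w ∈ T → t ∈ T
  T-^ w t^w∈T = T-resp (G.sym (^≈⇒≈ w G.refl)) (T-conj w t^w∈T)

  T² : ∀ {t} → t ∈ T → t ∙ t ≈ ε
  T² (z , s , eq) = G.trans (G.∙-cong eq eq) (solve (genᵢ s ∷ []) (z ∷ [])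
    (var 0F ⊙ inv 0F ⊙ var 0F ⁻ ⊙ (var 0F ⊙ inv 0F ⊙ var 0F ⁻)) one refl)

  Tᵢ : ∀ {t} → t ∈ T → Involution
  Tᵢ {t} t∈T = t , T² t∈T

  -- In t = zsz⁻¹ the contributions of z and z⁻¹ at t cancel, and the middle letter contributes t
  -- exactly once.
  η-self : ∀ {t} → t ∈ T → η t t ≡ true
  η-self {t} t∈T@(z , s , eq) = begin
    η t t                                              ≡⟨ η-cong eq G.refl ⟩
    η (z ∙ gen s ∙ z ⁻¹) t                             ≡⟨ η-∙ _ _ t ⟩
    η (z ∙ gen s) t xor η (z ⁻¹) (t ^ (z ∙ gen s))     ≡⟨ cong₂ _xor_ first last ⟩
    (η z t xor true) xor η z t                         ≡⟨ xor-cancel (η z t) ⟩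
    true                                               ∎
    where
    open ≡-Reasoning
    first : η (z ∙ gen s) t ≡ η z t xor true
    first = trans (η-∙ z (gen s) t) (cong (η z t xor_) (trans (η-gen s _) (≟-true (≈⇒^≈ z eq))))
    t^zsz⁻¹ : t ^ (z ∙ gen s) ^ z ⁻¹ ≈ t
    t^zsz⁻¹ = G.trans (G.sym (^-∙ t (z ∙ gen s) (z ⁻¹))) (G.trans (^-cong G.refl (G.sym eq))
      (solve (Tᵢ t∈T ∷ []) [] (inv 0F ⁻ ⊙ inv 0F ⊙ inv 0F) (inv 0F) refl))
    last : η (z ⁻¹) (t ^ (z ∙ gen s)) ≡ η z t
    last = trans (η-⁻¹ z _) (η-cong G.refl t^zsz⁻¹)
    xor-cancel : ∀ b → (b xor true) xor b ≡ true
    xor-cancel false = refl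
    xor-cancel true  = refl

  T≉ε : ∀ {t} → t ∈ T → t ≉ ε
  T≉ε {t} t∈T t≈ε = contradiction (trans (sym (η-self t∈T)) (trans (η-cong t≈ε G.refl) (η-ε t))) λ ()

  -- Strong exchange: an odd count forces t to occur in the reflection sequence of u, and deleting
  -- the letter where it occurs amounts to left multiplication by t. The last clause records that no
  -- new letters appear, which keeps words over J inside J.
  deletion : ∀ u t → count u t ≡ true → t ∈ T ×
             ∃ λ v → t ∙ ⟦ u ⟧ ≈ ⟦ v ⟧ × length v < length u × (∀ {P : Pred S a} → All P u → All P v)
  deletion (s ∷ u) t eq with em {P = t ≈ gen s}
  ... | yes t≈s = T-resp (G.sym t≈s) (gen∈T s) , u ,
    G.trans (G.∙-congʳ t≈s) (solve (genᵢ s ∷ []) (⟦ u ⟧ ∷ []) (inv 0F ⊙ (inv 0F ⊙ var 0F)) (var 0F) refl) ,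
    s≤s (≤-reflexive refl) , λ { (_ ∷ ps) → ps }
  ... | no _ with deletion u (t ^ gen s) eq
  ...   | t^s∈T , v , eqᵥ , lt , all = T-^ (gen s) t^s∈T , s ∷ v ,
    G.trans (solve (genᵢ s ∷ []) (t ∷ ⟦ u ⟧ ∷ []) (var 0F ⊙ (inv 0F ⊙ var 1F))
               (inv 0F ⊙ ((inv 0F ⁻ ⊙ var 0F ⊙ inv 0F) ⊙ var 1F)) refl) (G.∙-congˡ eqᵥ) ,
    s≤s lt , λ { (p ∷ ps) → p ∷ all ps }

  η-true⇒T : ∀ {w t} → η w t ≡ true → t ∈ T
  η-true⇒T {w} {t} eq = proj₁ (deletion (proj₁ (generates w)) t eq)

  η-true⇒ℓ> : ∀ {w t} → η w t ≡ true → ℓ (t ∙ w) < ℓ w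
  η-true⇒ℓ> {w} {t} eq with ℓ-reduced w
  ... | u , u≈w , len with deletion u t (trans (sym (η-word u u≈w t)) eq)
  ...   | _ , v , tu≈v , lt , _ = subst (ℓ (t ∙ w) <_) len
    (≤-trans (s≤s (ℓ-minimal (t ∙ w) v (G.trans (G.sym tu≈v) (G.∙-congˡ u≈w)))) lt)

  T-cancel : ∀ {t} → t ∈ T → ∀ w → t ∙ (t ∙ w) ≈ w
  T-cancel t∈T w = solve (Tᵢ t∈T ∷ []) (w ∷ []) (inv 0F ⊙ (inv 0F ⊙ var 0F)) (var 0F) refl

  -- Passing from w to tw flips the value at t, since `η t t` is true; the descent criterion then
  -- applies to tw.
  η-false⇒ℓ< : ∀ {w t} → t ∈ T → η w t ≡ false → ℓ w < ℓ (t ∙ w)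
  η-false⇒ℓ< {w} {t} t∈T eq = subst (_< ℓ (t ∙ w)) (ℓ-cong (T-cancel t∈T w)) (η-true⇒ℓ> (begin
    η (t ∙ w) t          ≡⟨ η-∙ t w t ⟩
    η t t xor η w (t ^ t) ≡⟨ cong₂ _xor_ (η-self t∈T) (trans (η-cong G.refl t^t) eq) ⟩
    true                 ∎))
    where
    open ≡-Reasoning
    t^t : t ^ t ≈ t
    t^t = solve (Tᵢ t∈T ∷ []) [] (inv 0F ⁻ ⊙ inv 0F ⊙ inv 0F) (inv 0F) refl

  ℓ>⇒η-true : ∀ {w t} → t ∈ T → ℓ (t ∙ w) < ℓ w → η w t ≡ true
  ℓ>⇒η-true {w} {t} t∈T lt with η w t in eq
  ... | true  = refl
  ... | false = contradiction lt (<-asym (η-false⇒ℓ< t∈T eq))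

  ℓ<⇒η-false : ∀ {w t} → ℓ w < ℓ (t ∙ w) → η w t ≡ false
  ℓ<⇒η-false {w} {t} lt with η w t in eq
  ... | false = refl
  ... | true  = contradiction lt (<-asym (η-true⇒ℓ> eq))

  first-letter : ∀ {w} → w ≉ ε → ∃ λ s → η w (gen s) ≡ true
  first-letter {w} w≉ε with ℓ-reduced w
  ... | []    , ε≈w , _   = contradiction (G.sym ε≈w) w≉ε
  ... | s ∷ u , eq  , len = s , ℓ>⇒η-true (gen∈T s) (subst (ℓ (gen s ∙ w) <_) len (s≤s (ℓ-minimal _ u
    (G.trans (solve (genᵢ s ∷ []) (⟦ u ⟧ ∷ []) (var 0F) (inv 0F ⊙ (inv 0F ⊙ var 0F)) refl) (G.∙-congˡ eq)))))

  -- The sign character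

  sgn : W → Parity
  sgn w = parity (length (proj₁ (generates w)))

  sgn-word : ∀ u {w} → ⟦ u ⟧ ≈ w → sgn w ≡ parity (length u)
  sgn-word u {w} eq = Presentation.∼-parity M (presents (proj₁ (generates w)) u (G.trans (proj₂ (generates w)) (G.sym eq)))

  sgn-cong : ∀ {v w} → v ≈ w → sgn v ≡ sgn w
  sgn-cong {v} {w} v≈w = sgn-word (proj₁ (generates w)) (G.trans (proj₂ (generates w)) (G.sym v≈w))

  sgn-∙ : ∀ v w → sgn (v ∙ w) ≡ sgn v +ℙ sgn w
  sgn-∙ v w with generates v | generates w
  ... | p , p≈v | q , q≈w = trans (sgn-word (p ++ q) (G.trans (⟦++⟧ p q) (G.∙-cong p≈v q≈w)))
    (trans (cong parity (length-++ p)) (+-homo-+ (length p) (length q)))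

  sgn-T : ∀ {t} → t ∈ T → sgn t ≡ 1ℙ
  sgn-T {t} (z , s , eq) = begin
    sgn t                                 ≡⟨ sgn-cong eq ⟩
    sgn (z ∙ gen s ∙ z ⁻¹)                ≡⟨ sgn-∙ _ _ ⟩
    sgn (z ∙ gen s) +ℙ sgn (z ⁻¹)         ≡⟨ cong (_+ℙ sgn (z ⁻¹)) (sgn-∙ z (gen s)) ⟩
    sgn z +ℙ sgn (gen s) +ℙ sgn (z ⁻¹)    ≡⟨ cong (λ p → sgn z +ℙ p +ℙ sgn (z ⁻¹)) (sgn-word (s ∷ []) (G.identityʳ _)) ⟩
    sgn z +ℙ 1ℙ +ℙ sgn (z ⁻¹)             ≡⟨ cancel (sgn z) (sgn (z ⁻¹)) (trans (sym (sgn-∙ z (z ⁻¹)))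
                                               (trans (sgn-cong (G.inverseʳ z)) (sgn-word [] G.refl))) ⟩
    1ℙ                                    ∎
    where
    open ≡-Reasoning
    cancel : ∀ p q → p +ℙ q ≡ 0ℙ → p +ℙ 1ℙ +ℙ q ≡ 1ℙ
    cancel 0ℙ 0ℙ _ = refl
    cancel 1ℙ 1ℙ _ = refl

  -- Canonical generators

  -- The closure properties of a subgroup on which the descent to canonical generators rests; both
  -- pass from V to sVs.
  record IsConjugationClosed (V : Pred W a) : Set a where
    field
      resp : ∀ {x y} → x ≈ y → x ∈ V → y ∈ V
      conj : ∀ {x y} → x ∈ V → y ∈ V → x ^ y ∈ V

  -- `CanonicalGenerators` rephrased through `η`: `only` is the inclusion N(c) ∩ V ⊆ {c}, and the
  -- reverse inclusion is `η-self`.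
  record Canonical (V : Pred W a) (c : W) : Set a where
    constructor canonical
    field
      ∈T   : c ∈ T
      ∈V   : c ∈ V
      only : ∀ {r} → r ∈ V → η c r ≡ true → r ≈ c

    false-at : ∀ {r} → r ∈ V → r ≉ c → η c r ≡ false
    false-at {r} r∈V r≉c with η c r in eq
    ... | false = refl
    ... | true  = contradiction (only r∈V eq) r≉c

  open Canonical using (∈T; ∈V; only; false-at)

  Canonical-resp : ∀ {V c c′} → IsConjugationClosed V → c ≈ c′ → Canonical V c → Canonical V c′
  Canonical-resp closed c≈c′ K = canonical (T-resp c≈c′ (∈T K)) (IsConjugationClosed.resp closed c≈c′ (∈V K))
    λ r∈V eq → G.trans (only K r∈V (trans (η-cong c≈c′ G.refl) eq)) c≈c′

  module SimpleConjugate {V : Pred W a} (closed : IsConjugationClosed V) {s : S} (s∉V : ¬ (gen s ∈ V)) where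
    open IsConjugationClosed closed
    private g = gen s

    ^s^s : ∀ y → y ^ g ^ g ≈ y
    ^s^s y = solve (genᵢ s ∷ []) (y ∷ []) (inv 0F ⁻ ⊙ (inv 0F ⁻ ⊙ var 0F ⊙ inv 0F) ⊙ inv 0F) (var 0F) refl

    Vˢ : Pred W a
    Vˢ y = y ^ g ∈ V

    ^s∈Vˢ : ∀ {y} → y ∈ V → y ^ g ∈ Vˢ
    ^s∈Vˢ {y} = resp (G.sym (^s^s y))

    closedˢ : IsConjugationClosed Vˢ
    closedˢ = record
      { resp = λ x≈y → resp (^-cong x≈y G.refl)
      ; conj = λ {y} {z} y∈ z∈ → resp (solve [] (y ∷ z ∷ g ∷ [])
          ((var 2F ⁻ ⊙ var 1F ⊙ var 2F) ⁻ ⊙ (var 2F ⁻ ⊙ var 0F ⊙ var 2F) ⊙ (var 2F ⁻ ⊙ var 1F ⊙ var 2F))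
          (var 2F ⁻ ⊙ (var 1F ⁻ ⊙ var 0F ⊙ var 1F) ⊙ var 2F) refl) (conj y∈ z∈) }

    ≟g-false : ∀ {y} → y ∈ V → (y ≟ g) ≡ false
    ≟g-false y∈V = ≟-false λ e → s∉V (resp e y∈V)

    η-s∙ : ∀ x {y} → y ∈ V → η x y ≡ η (g ∙ x) (y ^ g)
    η-s∙ x {y} y∈V = begin
      η x y                             ≡⟨ η-cong (T-cancel (gen∈T s) x) G.refl ⟨
      η (g ∙ (g ∙ x)) y                 ≡⟨ η-∙ g (g ∙ x) y ⟩
      η g y xor η (g ∙ x) (y ^ g)       ≡⟨ cong (_xor η (g ∙ x) (y ^ g)) (trans (η-gen s y) (≟g-false y∈V)) ⟩
      η (g ∙ x) (y ^ g)                 ∎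
      where open ≡-Reasoning

    -- Multiplying c by s on either side alters the value only if q, or the conjugate of q by scs,
    -- equals s. Both lie in V, and s does not.
    η-^s : ∀ {c q} → c ^ g ∈ V → q ∈ V → η (c ^ g) q ≡ η c (q ^ g)
    η-^s {c} {q} c^s∈V q∈V = begin
      η (c ^ g) q                              ≡⟨ η-s∙ (c ^ g) q∈V ⟩
      η (g ∙ (c ^ g)) (q ^ g)                  ≡⟨ η-cong (solve (genᵢ s ∷ []) (c ∷ [])
                                                    (inv 0F ⊙ (inv 0F ⁻ ⊙ var 0F ⊙ inv 0F)) (var 0F ⊙ inv 0F) refl) G.refl ⟩
      η (c ∙ g) (q ^ g)                        ≡⟨ η-∙ c g (q ^ g) ⟩
      η c (q ^ g) xor η g (q ^ g ^ c)          ≡⟨ cong (η c (q ^ g) xor_) (η-gen s _) ⟩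
      η c (q ^ g) xor ((q ^ g ^ c) ≟ g)        ≡⟨ cong (η c (q ^ g) xor_) (≟-false λ e → s∉V (resp (fixes e) (conj q∈V c^s∈V))) ⟩
      η c (q ^ g) xor false                    ≡⟨ xor-identityʳ _ ⟩
      η c (q ^ g)                              ∎
      where
      open ≡-Reasoning
      fixes : q ^ g ^ c ≈ g → q ^ (c ^ g) ≈ g
      fixes e = G.trans (solve (genᵢ s ∷ []) (q ∷ c ∷ [])
        ((inv 0F ⁻ ⊙ var 1F ⊙ inv 0F) ⁻ ⊙ var 0F ⊙ (inv 0F ⁻ ⊙ var 1F ⊙ inv 0F))
        (inv 0F ⊙ (var 1F ⁻ ⊙ (inv 0F ⁻ ⊙ var 0F ⊙ inv 0F) ⊙ var 1F) ⊙ inv 0F) refl)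
        (G.trans (G.∙-congʳ (G.∙-congˡ e)) (solve (genᵢ s ∷ []) [] (inv 0F ⊙ inv 0F ⊙ inv 0F) (inv 0F) refl))

    canonical-^s : ∀ {c} → Canonical Vˢ c → Canonical V (c ^ g)
    canonical-^s {c} K = canonical
      (T-resp (solve (genᵢ s ∷ []) (c ∷ []) (inv 0F ⊙ var 0F ⊙ inv 0F ⁻) (inv 0F ⁻ ⊙ var 0F ⊙ inv 0F) refl)
              (T-conj g (∈T K)))
      (∈V K)
      (λ {q} q∈V eq → G.trans (G.sym (^s^s q))
        (^-cong (only K (^s∈Vˢ q∈V) (trans (sym (η-^s (∈V K) q∈V)) eq)) G.refl))

  -- Induction on ℓ x: if the simple reflection s ∈ N(x) is not in V, pass to sx and sVs.
  canonical-descent : ∀ {V} → IsConjugationClosed V → ∀ {x r} → r ∈ V → η x r ≡ true →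
                      ∃ λ c → Canonical V c × η x c ≡ true
  canonical-descent closed {x} = descend closed (<-wellFounded (ℓ x))
    where
    descend : ∀ {V} → IsConjugationClosed V → ∀ {x r} → Acc _<_ (ℓ x) → r ∈ V → η x r ≡ true →
              ∃ λ c → Canonical V c × η x c ≡ true
    descend {V} closed {x} {r} (acc rec) r∈V xr with em {P = x ≈ ε}
    ... | yes x≈ε = contradiction (trans (sym xr) (trans (η-cong x≈ε G.refl) (η-ε r))) λ ()
    ... | no x≉ε with first-letter x≉ε
    ...   | s , xs with em {P = gen s ∈ V}
    ...     | yes s∈V = gen s , canonical (gen∈T s) s∈V (λ {q} _ eq → ≟-sound (trans (sym (η-gen s q)) eq)) , xs
    ...     | no s∉V =
      let open SimpleConjugate closed s∉V
          c , K , sxc = descend closedˢ (rec (η-true⇒ℓ> xs)) (^s∈Vˢ r∈V) (trans (sym (η-s∙ x r∈V)) xr)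
      in c ^ gen s , canonical-^s K , trans (η-s∙ x (∈V K)) (trans (η-cong G.refl (^s^s c)) sxc)

  CanonicalGenerators⇒Canonical : ∀ {V t} → t ∈ CanonicalGenerators V → Canonical V t
  CanonicalGenerators⇒Canonical (t∈T , N⊆ , N⊇) = canonical t∈T (proj₂ (N⊇ G.refl))
    λ r∈V eq → N⊆ ((η-true⇒T eq , η-true⇒ℓ> eq) , r∈V)

  Canonical⇒CanonicalGenerators : ∀ {V t} → IsConjugationClosed V → Canonical V t → t ∈ CanonicalGenerators V
  Canonical⇒CanonicalGenerators closed K = ∈T K ,
    (λ { ((r∈T , lt) , r∈V) → only K r∈V (ℓ>⇒η-true r∈T lt) }) ,
    (λ r≈t → (T-resp (G.sym r≈t) (∈T K) , η-true⇒ℓ> (trans (η-cong G.refl r≈t) (η-self (∈T K)))) ,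
             IsConjugationClosed.resp closed (G.sym r≈t) (∈V K))

  -- Bruhat steps and directed walks

  up⇒<ᴮ : ∀ {t u v} → t ∈ T → v ≈ t ∙ u → ℓ u < ℓ v → u <ᴮ v
  up⇒<ᴮ t∈T v≈tu lt = inj₂ [ _ , t∈T , v≈tu , lt ] , λ u≈v → <-irrefl (ℓ-cong u≈v) lt

  <ᴮ⇒ℓ< : ∀ {u v} → u <ᴮ v → ℓ u < ℓ v
  <ᴮ⇒ℓ< (inj₁ u≈v , u≉v) = contradiction u≈v u≉v
  <ᴮ⇒ℓ< (inj₂ steps , _) = ascend steps
    where
    ascend : ∀ {u v} → TransClosure BruhatStep u v → ℓ u < ℓ v
    ascend [ _ , _ , _ , lt ]             = lt
    ascend ((_ , _ , _ , lt) ∷ steps) = <-trans lt (ascend steps)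

  up⇒Ω : ∀ {t u v} → t ∈ T → v ≈ t ∙ u → ℓ u < ℓ v → Ω u v
  up⇒Ω {t} {u} {v} t∈T v≈tu lt = T-resp (G.sym (G.trans (G.∙-congˡ (G.⁻¹-cong v≈tu))
    (solve (Tᵢ t∈T ∷ []) (u ∷ []) (var 0F ⊙ (inv 0F ⊙ var 0F) ⁻) (inv 0F) refl))) t∈T , up⇒<ᴮ t∈T v≈tu lt

  walk-snoc : ∀ {Y n u v w t} → Walk Y n u v → w ∈ Y → t ∈ T → w ≈ t ∙ v → ℓ v < ℓ w → Walk Y (suc n) u w
  walk-snoc (stop u∈ _ u≈v) w∈ t∈T w≈tv lt =
    move u∈ w∈ (up⇒Ω t∈T (G.trans w≈tv (G.∙-congˡ (G.sym u≈v))) (subst (_< _) (ℓ-cong (G.sym u≈v)) lt)) (stop w∈ w∈ G.refl)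
  walk-snoc (move u∈ v∈ Ωuv walk) w∈ t∈T w≈tv lt = move u∈ v∈ Ωuv (walk-snoc walk w∈ t∈T w≈tv lt)

  walk-ℓ : ∀ {Y n u v} → Walk Y n u v → u ≈ v ⊎ ℓ u < ℓ v
  walk-ℓ (stop _ _ u≈v) = inj₁ u≈v
  walk-ℓ (move _ _ (_ , u<v) walk) with walk-ℓ walk
  ... | inj₁ v≈w = inj₂ (subst (_ <_) (ℓ-cong v≈w) (<ᴮ⇒ℓ< u<v))
  ... | inj₂ lt  = inj₂ (<-trans (<ᴮ⇒ℓ< u<v) lt)

  -- Subgroups generated by two reflections

  module Dihedral {p q : W} (p∈T : p ∈ T) (q∈T : q ∈ T) (p≉q : p ≉ q) where

    Generator : Pred W a
    Generator w = w ≈ p ⊎ w ≈ q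

    W′ : Pred W a
    W′ = ⟨ Generator ⟩

    p∈W′ : p ∈ W′
    p∈W′ = gen⟨⟩ (inj₁ G.refl)

    q∈W′ : q ∈ W′
    q∈W′ = gen⟨⟩ (inj₂ G.refl)

    Generator⊆T : ∀ {w} → w ∈ Generator → w ∈ T
    Generator⊆T (inj₁ w≈p) = T-resp (G.sym w≈p) p∈T
    Generator⊆T (inj₂ w≈q) = T-resp (G.sym w≈q) q∈T

    W′-^ : ∀ {x y} → x ∈ W′ → y ∈ W′ → x ^ y ∈ W′
    W′-^ x∈ y∈ = ∙⟨⟩ (∙⟨⟩ (⁻¹⟨⟩ y∈) x∈) y∈

    closed : IsConjugationClosed W′
    closed = record { resp = ≈⟨⟩ ; conj = W′-^ }

    letter : Bool → W
    letter true  = p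
    letter false = q

    letter∈T : ∀ b → letter b ∈ T
    letter∈T true  = p∈T
    letter∈T false = q∈T

    -- The alternating word of length 2k+1 in p and q that starts and ends with `letter b`.
    palindrome : ℕ → Bool → W
    palindrome zero    b = letter b
    palindrome (suc k) b = letter b ∙ palindrome k (not b) ∙ letter b

    palindrome∈T : ∀ k b → palindrome k b ∈ T
    palindrome∈T zero    b = letter∈T b
    palindrome∈T (suc k) b = T-resp (solve (Tᵢ (letter∈T b) ∷ []) (palindrome k (not b) ∷ [])
      (inv 0F ⊙ var 0F ⊙ inv 0F ⁻) (inv 0F ⊙ var 0F ⊙ inv 0F) refl) (T-conj (letter b) (palindrome∈T k (not b)))

    -- Both sides spell the alternating word of length 2k+2 that begins with `letter b`.
    palindrome-swap : ∀ k b → palindrome k b ∙ letter (not b) ≈ letter b ∙ palindrome k (not b)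
    palindrome-swap zero    b     = G.refl
    palindrome-swap (suc k) true  = G.trans (solve [] (p ∷ q ∷ palindrome k false ∷ [])
      (var 0F ⊙ var 2F ⊙ var 0F ⊙ var 1F) (var 0F ⊙ (var 2F ⊙ var 0F ⊙ var 1F)) refl)
      (G.∙-congˡ (G.∙-congʳ (palindrome-swap k false)))
    palindrome-swap (suc k) false = G.trans (solve [] (q ∷ p ∷ palindrome k true ∷ [])
      (var 0F ⊙ var 2F ⊙ var 0F ⊙ var 1F) (var 0F ⊙ (var 2F ⊙ var 0F ⊙ var 1F)) refl)
      (G.∙-congˡ (G.∙-congʳ (palindrome-swap k true)))

    -- Alternating words sorted by the parity of their length. Different shapes may denote the same
    -- element, so finite and infinite W′ are treated alike.
    data Shape (x : W) : Set a where
      unit : x ≈ ε → Shape x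
      odd  : ∀ k b → x ≈ palindrome k b → Shape x
      even : ∀ k b → x ≈ letter (not b) ∙ palindrome k b → Shape x

    shape-resp : ∀ {x y} → x ≈ y → Shape x → Shape y
    shape-resp x≈y (unit e)     = unit (G.trans (G.sym x≈y) e)
    shape-resp x≈y (odd k b e)  = odd k b (G.trans (G.sym x≈y) e)
    shape-resp x≈y (even k b e) = even k b (G.trans (G.sym x≈y) e)

    letter-odd : ∀ k b b′ {x} → x ≈ palindrome k b → Shape (letter b′ ∙ x)
    letter-odd k       true  false e = even k true (G.∙-congˡ e)
    letter-odd k       false true  e = even k false (G.∙-congˡ e)
    letter-odd zero    true  true  e = unit (G.trans (G.∙-congˡ e) (T² p∈T))
    letter-odd zero    false false e = unit (G.trans (G.∙-congˡ e) (T² q∈T))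
    letter-odd (suc k) true  true  e = even k true (G.trans (G.∙-congˡ (G.trans e (G.assoc _ _ _)))
      (G.trans (T-cancel p∈T _) (palindrome-swap k false)))
    letter-odd (suc k) false false e = even k false (G.trans (G.∙-congˡ (G.trans e (G.assoc _ _ _)))
      (G.trans (T-cancel q∈T _) (palindrome-swap k true)))

    letter-even : ∀ k b b′ {x} → x ≈ letter (not b) ∙ palindrome k b → Shape (letter b′ ∙ x)
    letter-even k true  false e = odd k true (G.trans (G.∙-congˡ e) (T-cancel q∈T _))
    letter-even k false true  e = odd k false (G.trans (G.∙-congˡ e) (T-cancel p∈T _))
    letter-even k true  true  e = odd (suc k) true
      (G.trans (G.∙-congˡ (G.trans e (G.sym (palindrome-swap k false)))) (G.sym (G.assoc _ _ _)))
    letter-even k false false e = odd (suc k) false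
      (G.trans (G.∙-congˡ (G.trans e (G.sym (palindrome-swap k true)))) (G.sym (G.assoc _ _ _)))

    letter-shape : ∀ b {x} → Shape x → Shape (letter b ∙ x)
    letter-shape b (unit e)      = odd 0 b (G.trans (G.∙-congˡ e) (G.identityʳ _))
    letter-shape b (odd k b′ e)  = letter-odd k b′ b e
    letter-shape b (even k b′ e) = letter-even k b′ b e

    T⁻¹ : ∀ {t} → t ∈ T → t ⁻¹ ≈ t
    T⁻¹ t∈T = solve (Tᵢ t∈T ∷ []) [] (inv 0F ⁻) (inv 0F) refl

    generator-shape : ∀ {w} → w ∈ Generator → ∀ {x} → Shape x → Shape (w ∙ x)
    generator-shape (inj₁ w≈p) sh = shape-resp (G.∙-congʳ (G.sym w≈p)) (letter-shape true sh)
    generator-shape (inj₂ w≈q) sh = shape-resp (G.∙-congʳ (G.sym w≈q)) (letter-shape false sh)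

    -- Proved for w and w⁻¹ together, so that the inverse constructor merely exchanges the two
    -- halves.
    shape-∙ : ∀ {w} → w ∈ W′ → (∀ {x} → Shape x → Shape (w ∙ x)) × (∀ {x} → Shape x → Shape (w ⁻¹ ∙ x))
    shape-∙ (gen⟨⟩ w∈) = generator-shape w∈ ,
      λ sh → shape-resp (G.∙-congʳ (G.sym (T⁻¹ (Generator⊆T w∈)))) (generator-shape w∈ sh)
    shape-∙ ε⟨⟩ = shape-resp (G.sym (G.identityˡ _)) ,
      shape-resp (solve [] (_ ∷ []) (var 0F) (one ⁻ ⊙ var 0F) refl)
    shape-∙ (∙⟨⟩ v∈ w∈) with shape-∙ v∈ | shape-∙ w∈
    ... | v⁺ , v⁻ | w⁺ , w⁻ =
      (λ sh → shape-resp (G.sym (G.assoc _ _ _)) (v⁺ (w⁺ sh))) ,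
      (λ sh → shape-resp (G.trans (G.sym (G.assoc _ _ _)) (G.∙-congʳ (G.sym (⁻¹-anti-homo-∙ _ _)))) (w⁻ (v⁻ sh)))
    shape-∙ (⁻¹⟨⟩ w∈) with shape-∙ w∈
    ... | w⁺ , w⁻ = w⁻ , λ sh → shape-resp (solve [] (_ ∷ _ ∷ []) (var 0F ⊙ var 1F) (var 0F ⁻ ⁻ ⊙ var 1F) refl) (w⁺ sh)
    shape-∙ (≈⟨⟩ v≈w v∈) with shape-∙ v∈
    ... | v⁺ , v⁻ = (λ sh → shape-resp (G.∙-congʳ v≈w) (v⁺ sh)) ,
                    (λ sh → shape-resp (G.∙-congʳ (G.⁻¹-cong v≈w)) (v⁻ sh))

    shape : ∀ {w} → w ∈ W′ → Shape w
    shape w∈ = shape-resp (G.identityʳ _) (proj₁ (shape-∙ w∈) (unit G.refl))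

    -- An alternating word of odd sign has odd length, hence is a palindrome, hence a conjugate of p
    -- or q. This is where having only two generators matters.
    odd⇒T : ∀ {w} → w ∈ W′ → sgn w ≡ 1ℙ → w ∈ T
    odd⇒T w∈ sgn≡1 with shape w∈
    ... | unit e     = contradiction (trans (sym sgn≡1) (trans (sgn-cong e) (sgn-word [] G.refl))) λ ()
    ... | odd k b e  = T-resp (G.sym e) (palindrome∈T k b)
    ... | even k b e = contradiction (trans (sym sgn≡1) (trans (sgn-cong e) (trans (sgn-∙ _ _)
                         (cong₂ _+ℙ_ (sgn-T (letter∈T (not b))) (sgn-T (palindrome∈T k b)))))) λ ()

    -- An odd y would be a reflection in its own N(y). For even y and canonical ρ, the reflection yρ
    -- lies in N(yρ) = N(y) + yN(ρ)y⁻¹ but not in N(y); so its conjugate (yρ)^y = ρy lies in N(ρ),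
    -- which forces ρy = ρ.
    no-descent⇒ε : ∀ {y} → y ∈ W′ → (∀ {r} → r ∈ W′ → η y r ≡ false) → y ≈ ε
    no-descent⇒ε {y} y∈ none with sgn y in sgn-y
    ... | 1ℙ = contradiction (trans (sym (η-self (odd⇒T y∈ sgn-y))) (none y∈)) λ ()
    ... | 0ℙ with canonical-descent closed p∈W′ (η-self p∈T)
    ...   | ρ , K , _ = ∙-cancelˡ ρ y ε (G.trans (G.trans
              (solve [] (y ∷ ρ ∷ []) (var 1F ⊙ var 0F) (var 0F ⁻ ⊙ (var 0F ⊙ var 1F) ⊙ var 0F) refl)
              (only K (W′-^ yρ∈ y∈) (begin
                η ρ ((y ∙ ρ) ^ y)                        ≡⟨ cong (_xor η ρ ((y ∙ ρ) ^ y)) (none yρ∈) ⟨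
                η y (y ∙ ρ) xor η ρ ((y ∙ ρ) ^ y)      ≡⟨ η-∙ y ρ (y ∙ ρ) ⟨
                η (y ∙ ρ) (y ∙ ρ)                      ≡⟨ η-self (odd⇒T yρ∈ (trans (sgn-∙ y ρ) (cong₂ _+ℙ_ sgn-y (sgn-T (∈T K))))) ⟩
                true                                   ∎)))
              (G.sym (G.identityʳ ρ)))
      where
      open ≡-Reasoning
      yρ∈ : y ∙ ρ ∈ W′
      yρ∈ = ∙⟨⟩ y∈ (∈V K)

    has-canonical-descent : ∀ {y} → y ∈ W′ → y ≉ ε → ∃ λ c → Canonical W′ c × η y c ≡ true
    has-canonical-descent {y} y∈ y≉ε with em {P = ∃ λ r → r ∈ W′ × η y r ≡ true}
    ... | yes (r , r∈ , eq) = canonical-descent closed r∈ eq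
    ... | no none = contradiction (no-descent⇒ε y∈ λ r∈ → ¬-not λ eq → none (_ , r∈ , eq)) y≉ε

    -- For three distinct canonical generators the reflection w = ρτσ would satisfy
    -- w ∉ N(w), because N(w) ∩ W′ ⊆ {ρ, ρτρ, ρτστρ}.
    at-most-two : ∀ {ρ σ τ} → Canonical W′ ρ → Canonical W′ σ → Canonical W′ τ → ρ ≉ σ → ρ ≉ τ → σ ≈ τ
    at-most-two {ρ} {σ} {τ} R K U ρ≉σ ρ≉τ with em {P = σ ≈ τ}
    ... | yes σ≈τ = σ≈τ
    ... | no σ≉τ = contradiction (trans (sym (η-self w∈T)) (begin
      η w w                                        ≡⟨ η-∙ (ρ ∙ τ) σ w ⟩
      η (ρ ∙ τ) w xor η σ (w ^ (ρ ∙ τ))            ≡⟨ cong (_xor η σ (w ^ (ρ ∙ τ))) (η-∙ ρ τ w) ⟩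
      (η ρ w xor η τ (w ^ ρ)) xor η σ (w ^ (ρ ∙ τ))
        ≡⟨ cong₂ _xor_ (cong₂ _xor_ (false-at R w∈ w≉ρ) (false-at U (W′-^ w∈ (∈V R)) w^ρ≉τ))
                       (false-at K (W′-^ w∈ (∙⟨⟩ (∈V R) (∈V U))) w^ρτ≉σ) ⟩
      false                                        ∎)) λ ()
      where
      open ≡-Reasoning
      w = ρ ∙ τ ∙ σ
      involutions = Tᵢ (∈T R) ∷ Tᵢ (∈T U) ∷ Tᵢ (∈T K) ∷ []
      w∈ : w ∈ W′
      w∈ = ∙⟨⟩ (∙⟨⟩ (∈V R) (∈V U)) (∈V K)
      w∈T : w ∈ T
      w∈T = odd⇒T w∈ (trans (sgn-∙ _ _) (cong₂ _+ℙ_ (trans (sgn-∙ _ _)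
              (cong₂ _+ℙ_ (sgn-T (∈T R)) (sgn-T (∈T U)))) (sgn-T (∈T K))))
      w≉ρ : w ≉ ρ
      w≉ρ e = σ≉τ (G.trans
        (solve involutions [] (inv 2F) (inv 1F ⊙ inv 0F ⊙ (inv 0F ⊙ inv 1F ⊙ inv 2F)) refl)
        (G.trans (G.∙-congˡ e) (solve involutions [] (inv 1F ⊙ inv 0F ⊙ inv 0F) (inv 1F) refl)))
      w^ρ≉τ : w ^ ρ ≉ τ
      w^ρ≉τ e = ρ≉σ (G.trans
        (solve involutions [] (inv 0F) (inv 2F ⊙ inv 1F ⊙ (inv 0F ⁻ ⊙ (inv 0F ⊙ inv 1F ⊙ inv 2F) ⊙ inv 0F)) refl)
        (G.trans (G.∙-congˡ e) (solve involutions [] (inv 2F ⊙ inv 1F ⊙ inv 1F) (inv 2F) refl)))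
      w^ρτ≉σ : w ^ (ρ ∙ τ) ≉ σ
      w^ρτ≉σ e = ρ≉τ (G.trans
        (solve involutions [] (inv 0F)
          (inv 2F ⊙ ((inv 0F ⊙ inv 1F) ⁻ ⊙ (inv 0F ⊙ inv 1F ⊙ inv 2F) ⊙ (inv 0F ⊙ inv 1F)) ⊙ inv 1F) refl)
        (G.trans (G.∙-congʳ (G.∙-congˡ e)) (solve involutions [] (inv 2F ⊙ inv 2F ⊙ inv 1F) (inv 1F) refl)))

    -- Given a canonical ρ and another reflection r of W′, one of r and ρr does not have ρ as a
    -- descent, because left multiplication by ρ flips this. A canonical descent of that element is
    -- the second generator.
    two-canonicals : ∃₂ λ ρ σ → Canonical W′ ρ × Canonical W′ σ × ρ ≉ σ
    two-canonicals with canonical-descent closed p∈W′ (η-self p∈T)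
    ... | ρ , R , _ with other
      where
      other : ∃ λ r → r ∈ T × r ∈ W′ × r ≉ ρ
      other with em {P = p ≈ ρ}
      ... | yes p≈ρ = q , q∈T , q∈W′ , λ q≈ρ → p≉q (G.trans p≈ρ (G.sym q≈ρ))
      ... | no p≉ρ  = p , p∈T , p∈W′ , p≉ρ
    ... | r , r∈T , r∈ , r≉ρ with η r ρ in rρ
    ...   | false with canonical-descent closed r∈ (η-self r∈T)
    ...     | σ , K , rσ = ρ , σ , R , K , λ ρ≈σ →
      contradiction (trans (sym rσ) (trans (η-cong G.refl (G.sym ρ≈σ)) rρ)) λ ()
    two-canonicals | ρ , R , _ | r , r∈T , r∈ , r≉ρ | true
      with has-canonical-descent (∙⟨⟩ (∈V R) r∈) (λ e → r≉ρ (G.trans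
             (G.trans (G.sym (T-cancel (∈T R) r)) (G.∙-congˡ e)) (G.identityʳ ρ)))
    ...     | σ , K , ρrσ = ρ , σ , R , K , λ ρ≈σ → contradiction (begin
      true                        ≡⟨ ρrσ ⟨
      η (ρ ∙ r) σ                 ≡⟨ η-cong G.refl ρ≈σ ⟨
      η (ρ ∙ r) ρ                 ≡⟨ η-∙ ρ r ρ ⟩
      η ρ ρ xor η r (ρ ^ ρ)       ≡⟨ cong₂ _xor_ (η-self (∈T R)) (trans (η-cong G.refl
                                       (solve (Tᵢ (∈T R) ∷ []) [] (inv 0F ⁻ ⊙ inv 0F ⊙ inv 0F) (inv 0F) refl)) rρ) ⟩
      false                       ∎) λ ()
      where open ≡-Reasoning

    isReflectionSubgroup : IsReflectionSubgroup W′
    isReflectionSubgroup = Generator , Generator⊆T , (λ x → x) , (λ x → x)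

    isDihedral : IsDihedral W′
    isDihedral with two-canonicals
    ... | ρ , σ , R , K , ρ≉σ = ρ , σ , ρ≉σ , forth , back
      where
      forth : ∀ {t} → t ∈ CanonicalGenerators W′ → t ≈ ρ ⊎ t ≈ σ
      forth {t} t∈ with em {P = t ≈ ρ}
      ... | yes t≈ρ = inj₁ t≈ρ
      ... | no t≉ρ  = inj₂ (at-most-two R (CanonicalGenerators⇒Canonical t∈) K (λ e → t≉ρ (G.sym e)) ρ≉σ)
      back : ∀ {t} → t ≈ ρ ⊎ t ≈ σ → t ∈ CanonicalGenerators W′
      back (inj₁ t≈ρ) = Canonical⇒CanonicalGenerators closed (Canonical-resp closed (G.sym t≈ρ) R)
      back (inj₂ t≈σ) = Canonical⇒CanonicalGenerators closed (Canonical-resp closed (G.sym t≈σ) K)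

    -- Canonical descents are stripped from x until a canonical generator remains, and the walk is
    -- rebuilt upwards. If the generator that remains is not c, the last letter removed was c, and
    -- the first arrow has to be found separately.
    reach : ∀ {x c} → x ∈ W′ → Canonical W′ c → x ≈ ε ⊎ Canonical W′ x ⊎ FiniteDistance W′ c x
    reach {x₀} {c} x₀∈ K = search x₀∈ (<-wellFounded (ℓ x₀))
      where
      search : ∀ {x} → x ∈ W′ → Acc _<_ (ℓ x) → x ≈ ε ⊎ Canonical W′ x ⊎ FiniteDistance W′ c x
      search {x} x∈ (acc rec) with em {P = x ≈ ε}
      ... | yes x≈ε = inj₁ x≈ε
      ... | no x≉ε with has-canonical-descent x∈ x≉ε
      ...   | d , D , xd with search (∙⟨⟩ (∈V D) x∈) (rec (η-true⇒ℓ> xd))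
      ...     | inj₁ dx≈ε = inj₂ (inj₁ (Canonical-resp closed
                  (G.trans (G.trans (G.sym (G.identityʳ d)) (G.∙-congˡ (G.sym dx≈ε))) (T-cancel (∈T D) x)) D))
      ...     | inj₂ (inj₂ (n , walk)) = inj₂ (inj₂ (suc n ,
                  walk-snoc walk x∈ (∈T D) (G.sym (T-cancel (∈T D) x)) (η-true⇒ℓ> xd)))
      ...     | inj₂ (inj₁ E) with em {P = d ≈ c}
      ...       | no d≉c = inj₂ (inj₂ (1 , move (∈V K) x∈ (up⇒Ω (∈T D)
                  (G.trans (G.sym (T-cancel (∈T D) x)) (G.∙-congˡ (G.sym c≈dx)))
                  (subst (_< ℓ x) (ℓ-cong (G.sym c≈dx)) (η-true⇒ℓ> xd))) (stop x∈ x∈ G.refl)))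
        where
        d≉dx : d ≉ d ∙ x
        d≉dx e = x≉ε (∙-cancelˡ d x ε (G.trans (G.sym e) (G.sym (G.identityʳ d))))
        c≈dx : c ≈ d ∙ x
        c≈dx = at-most-two D K E d≉c d≉dx
      -- Here x = ce with e = dx canonical, and left multiplication by c leads to e instead of c.
      -- The conjugate r = ded⁻¹ gives x = rc, and the arrow points upwards because N(c) meets W′
      -- only in c.
      ...       | yes d≈c = inj₂ (inj₂ (1 , move (∈V K) x∈ (up⇒Ω r∈T x≈rc
                  (subst (ℓ c <_) (ℓ-cong (G.sym x≈rc)) (η-false⇒ℓ< r∈T (false-at K r∈W′ r≉c)))) (stop x∈ x∈ G.refl)))
        where
        r = d ∙ (d ∙ x) ∙ d ⁻¹
        r∈T : r ∈ T
        r∈T = T-conj d (∈T E)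
        r∈W′ : r ∈ W′
        r∈W′ = ∙⟨⟩ (∙⟨⟩ (∈V D) (∈V E)) (⁻¹⟨⟩ (∈V D))
        x≈rc : x ≈ r ∙ c
        x≈rc = G.trans (solve (Tᵢ (∈T D) ∷ []) (x ∷ []) (var 0F) (inv 0F ⊙ (inv 0F ⊙ var 0F) ⊙ inv 0F ⁻ ⊙ inv 0F) refl)
                       (G.∙-congˡ d≈c)
        r≉c : r ≉ c
        r≉c e = x≉ε (G.trans
          (solve (Tᵢ (∈T D) ∷ []) (x ∷ []) (var 0F) (inv 0F ⊙ (inv 0F ⊙ var 0F) ⊙ inv 0F ⁻ ⊙ inv 0F) refl)
          (G.trans (G.∙-congʳ (G.trans e (G.sym d≈c))) (T² (∈T D))))

  -- Ascents in cosets of dihedral reflection subgroups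

  _·_·⁻¹ : W → S → W
  z · s ·⁻¹ = z ∙ gen s ∙ z ⁻¹

  ∙gen≈ : ∀ z s → (z · s ·⁻¹) ∙ z ≈ z ∙ gen s
  ∙gen≈ z s = solve [] (z ∷ gen s ∷ []) (var 0F ⊙ var 1F ⊙ var 0F ⁻ ⊙ var 0F) (var 0F ⊙ var 1F) refl

  ·⁻¹∈T : ∀ z s → (z · s ·⁻¹) ∈ T
  ·⁻¹∈T z s = z , s , G.refl

  -- Equivalent to ℓ z < ℓ (z ∙ gen s).
  Ascent : S → Pred W _
  Ascent s z = η z (z · s ·⁻¹) ≡ false

  ℓ<⇒Ascent : ∀ {s z} → ℓ z < ℓ (z ∙ gen s) → Ascent s z
  ℓ<⇒Ascent {s} {z} lt = (ℓ<⇒η-false (subst (ℓ z <_) (ℓ-cong (G.sym (∙gen≈ z s))) lt))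

  Ascent⇒ℓ< : ∀ {s z} → Ascent s z → ℓ z < ℓ (z ∙ gen s)
  Ascent⇒ℓ< {s} {z} asc = subst (ℓ z <_) (ℓ-cong (∙gen≈ z s)) (η-false⇒ℓ< (·⁻¹∈T z s) asc)

  Ascent-resp : ∀ {s y z} → y ≈ z → Ascent s y → Ascent s z
  Ascent-resp y≈z asc = (trans (η-cong (G.sym y≈z) (G.∙-cong (G.∙-congʳ (G.sym y≈z)) (G.⁻¹-cong (G.sym y≈z)))) asc)

  ∙gen-gen : ∀ w s → w ∙ gen s ∙ gen s ≈ w
  ∙gen-gen w s = solve (genᵢ s ∷ []) (w ∷ []) (var 0F ⊙ inv 0F ⊙ inv 0F) (var 0F) refl

  -- The elements z of a coset of W′ with ℓ z < ℓ (zs) form a chain under left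
  -- multiplication by canonical generators of W′.
  module Climbing {p q : W} (p∈T : p ∈ T) (q∈T : q ∈ T) (p≉q : p ≉ q) (s : S) where
    open Dihedral p∈T q∈T p≉q public

    data Climb : W → W → Set a where
      done : ∀ {x y} → x ≈ y → Climb x y
      step : ∀ {x y} c → Canonical W′ c → ℓ x < ℓ (c ∙ x) → Ascent s (c ∙ x) → Climb (c ∙ x) y → Climb x y

    climb-respˡ : ∀ {x x′ y} → x ≈ x′ → Climb x y → Climb x′ y
    climb-respˡ x≈x′ (done x≈y) = done (G.trans (G.sym x≈x′) x≈y)
    climb-respˡ x≈x′ (step c K lt asc climb) = step c K
      (subst₂ _<_ (ℓ-cong x≈x′) (ℓ-cong (G.∙-congˡ x≈x′)) lt) (Ascent-resp (G.∙-congˡ x≈x′) asc)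
      (climb-respˡ (G.∙-congˡ x≈x′) climb)

    climb-respʳ : ∀ {x y y′} → y ≈ y′ → Climb x y → Climb x y′
    climb-respʳ y≈y′ (done x≈y) = done (G.trans x≈y y≈y′)
    climb-respʳ y≈y′ (step c K lt asc climb) = step c K lt asc (climb-respʳ y≈y′ climb)

    climb-snoc : ∀ {x y c} → Climb x y → Canonical W′ c → ℓ y < ℓ (c ∙ y) → Ascent s (c ∙ y) → Climb x (c ∙ y)
    climb-snoc (done x≈y) K lt asc = climb-respˡ (G.sym x≈y) (step _ K lt asc (done G.refl))
    climb-snoc (step d D lt′ asc′ climb) K lt asc = step d D lt′ asc′ (climb-snoc climb K lt asc)

    climb-ℓ : ∀ {x y} → Climb x y → ℓ x ≤ ℓ y
    climb-ℓ (done x≈y)             = ≤-reflexive (ℓ-cong x≈y)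
    climb-ℓ (step _ _ lt _ climb) = ≤-trans (<⇒≤ lt) (climb-ℓ climb)

    conj-coset : ∀ {x y} → (x · s ·⁻¹) ∈ W′ → y ∙ x ⁻¹ ∈ W′ → (y · s ·⁻¹) ∈ W′
    conj-coset {x} {y} x∈ yx⁻¹∈ = ≈⟨⟩ (solve [] (x ∷ y ∷ gen s ∷ [])
      (var 1F ⊙ var 0F ⁻ ⊙ (var 0F ⊙ var 2F ⊙ var 0F ⁻) ⊙ (var 1F ⊙ var 0F ⁻) ⁻) (var 1F ⊙ var 2F ⊙ var 1F ⁻) refl)
      (∙⟨⟩ (∙⟨⟩ yx⁻¹∈ x∈) (⁻¹⟨⟩ yx⁻¹∈))

    conj-∙ : ∀ {c z} → c ∈ W′ → (z · s ·⁻¹) ∈ W′ → ((c ∙ z) · s ·⁻¹) ∈ W′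
    conj-∙ {c} {z} c∈ z∈ = conj-coset z∈ (≈⟨⟩ (solve [] (c ∷ z ∷ []) (var 0F) (var 0F ⊙ var 1F ⊙ var 1F ⁻) refl) c∈)

    conj-^ : ∀ c z → ((c ∙ z) · s ·⁻¹) ^ c ≈ z · s ·⁻¹
    conj-^ c z = solve [] (c ∷ z ∷ gen s ∷ [])
      (var 0F ⁻ ⊙ (var 0F ⊙ var 1F ⊙ var 2F ⊙ (var 0F ⊙ var 1F) ⁻) ⊙ var 0F) (var 1F ⊙ var 2F ⊙ var 1F ⁻) refl

    -- As N(c) meets W′ only in c, the ascent could be lost only if czs(cz)⁻¹ = c, that is zsz⁻¹ =
    -- c. But c lies in N(z) and zsz⁻¹ does not.
    ascent-descent : ∀ {c z} → Canonical W′ c → (z · s ·⁻¹) ∈ W′ → Ascent s z → η z c ≡ true → Ascent s (c ∙ z)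
    ascent-descent {c} {z} K z∈ asc zc = (begin
      η (c ∙ z) r                  ≡⟨ η-∙ c z r ⟩
      η c r xor η z (r ^ c)        ≡⟨ cong₂ _xor_ (false-at K (conj-∙ (∈V K) z∈) r≉c) (trans (η-cong G.refl (conj-^ c z)) asc) ⟩
      false                        ∎)
      where
      open ≡-Reasoning
      r = (c ∙ z) · s ·⁻¹
      r≉c : r ≉ c
      r≉c r≈c = contradiction (trans (sym zc) (trans (η-cong G.refl (G.trans c≈r^c (conj-^ c z))) asc)) λ ()
        where
        c≈r^c : c ≈ r ^ c
        c≈r^c = G.trans (solve [] (c ∷ []) (var 0F) (var 0F ⁻ ⊙ var 0F ⊙ var 0F) refl) (^-cong (G.sym r≈c) G.refl)

    module _ {z : W} (z∈ : (z · s ·⁻¹) ∈ W′) where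

      -- At the bottom z of the coset, zsz⁻¹ is canonical, and zsz⁻¹ ∙ z = zs is not an ascent.
      bottom-canonical : (∀ {r} → r ∈ W′ → η z r ≡ false) → Canonical W′ (z · s ·⁻¹)
      bottom-canonical none = canonical (·⁻¹∈T z s) z∈ λ {r} r∈ ρr → G.trans (^≈⇒≈ z (≟-sound (begin
        ((r ^ z) ≟ gen s)                       ≡⟨ η-gen s _ ⟨
        η (gen s) (r ^ z)                       ≡⟨ cong (_xor η (gen s) (r ^ z)) (none r∈) ⟨
        η z r xor η (gen s) (r ^ z)             ≡⟨ η-∙ z (gen s) r ⟨
        η (z ∙ gen s) r                         ≡⟨ η-cong (∙gen≈ z s) G.refl ⟨
        η (ρ ∙ z) r                             ≡⟨ η-∙ ρ z r ⟩
        η ρ r xor η z (r ^ ρ)                   ≡⟨ cong₂ _xor_ ρr (none (W′-^ r∈ z∈)) ⟩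
        true                                    ∎))) G.refl
        where
        open ≡-Reasoning
        ρ = z · s ·⁻¹

      -- A generator that cannot continue the climb at z. With `at-most-two` it leaves a single
      -- candidate for the next step.
      other-canonical : ∃ λ ρ → Canonical W′ ρ × (∀ {c} → Canonical W′ c → ℓ z < ℓ (c ∙ z) → Ascent s (c ∙ z) → ρ ≉ c)
      other-canonical with em {P = ∃ λ r → r ∈ W′ × η z r ≡ true}
      ... | yes (r , r∈ , zr) = let ρ , R , zρ = canonical-descent closed r∈ zr in ρ , R ,
        λ K lt _ ρ≈c → contradiction (trans (sym zρ) (trans (η-cong G.refl ρ≈c) (ℓ<⇒η-false lt))) λ ()
      ... | no none = z · s ·⁻¹ , bottom-canonical (λ r∈ → ¬-not λ eq → none (_ , r∈ , eq)) ,
        λ {c} K lt asc ρ≈c →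
          let cz≈zs = G.trans (G.∙-congʳ (G.sym ρ≈c)) (∙gen≈ z s)
          in <-asym lt (subst (ℓ (c ∙ z) <_) (ℓ-cong (G.trans (G.∙-congʳ cz≈zs) (∙gen-gen z s))) (Ascent⇒ℓ< asc))

      ascent-unique : ∀ {c d} → Canonical W′ c → ℓ z < ℓ (c ∙ z) → Ascent s (c ∙ z) →
                      Canonical W′ d → ℓ z < ℓ (d ∙ z) → Ascent s (d ∙ z) → c ≈ d
      ascent-unique K ltᶜ ascᶜ D ltᵈ ascᵈ with other-canonical
      ... | ρ , R , ρ≉ = at-most-two R K D (ρ≉ K ltᶜ ascᶜ) (ρ≉ D ltᵈ ascᵈ)

      -- Moves one endpoint from z to its successor cz: a climb arriving at z is prolonged, and one
      -- leaving z must begin with c by uniqueness.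
      extend : ∀ {y c} → Canonical W′ c → ℓ z < ℓ (c ∙ z) → Ascent s (c ∙ z) →
               Climb z y ⊎ Climb y z → Climb (c ∙ z) y ⊎ Climb y (c ∙ z)
      extend K lt asc (inj₂ climb)      = inj₂ (climb-snoc climb K lt asc)
      extend K lt asc (inj₁ (done z≈y)) = inj₂ (climb-respˡ z≈y (step _ K lt asc (done G.refl)))
      extend K lt asc (inj₁ (step d D lt′ asc′ climb)) =
        inj₁ (climb-respˡ (G.∙-congʳ (ascent-unique D lt′ asc′ K lt asc)) climb)

    extend-back : ∀ {x y c} → Canonical W′ c → (x · s ·⁻¹) ∈ W′ → Ascent s x → η x c ≡ true →
                  Climb (c ∙ x) y ⊎ Climb y (c ∙ x) → Climb x y ⊎ Climb y x
    extend-back {x} {y} {c} K x∈ asc xc climb with extend (conj-∙ (∈V K) x∈) K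
        (subst (ℓ (c ∙ x) <_) (ℓ-cong (G.sym ccx)) (η-true⇒ℓ> xc)) (Ascent-resp (G.sym ccx) asc) climb
      where
      ccx : c ∙ (c ∙ x) ≈ x
      ccx = T-cancel (∈T K) x
    ... | inj₁ climb′ = inj₁ (climb-respˡ (T-cancel (∈T K) x) climb′)
    ... | inj₂ climb′ = inj₂ (climb-respʳ (T-cancel (∈T K) x) climb′)

    -- Canonical descents are stripped from x and then from y, staying among the ascents, until both
    -- are at the bottom of the coset; the comparison is carried back up one step at a time.
    compare : ∀ {x y} → (x · s ·⁻¹) ∈ W′ → y ∙ x ⁻¹ ∈ W′ → Ascent s x → Ascent s y → Climb x y ⊎ Climb y x
    compare {x₀} {y₀} = go (<-wellFounded (ℓ x₀ + ℓ y₀))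
      where
      go : ∀ {x y} → Acc _<_ (ℓ x + ℓ y) → (x · s ·⁻¹) ∈ W′ → y ∙ x ⁻¹ ∈ W′ → Ascent s x → Ascent s y →
           Climb x y ⊎ Climb y x
      go {x} {y} (acc rec) x∈ yx⁻¹∈ ascˣ ascʸ with em {P = ∃ λ r → r ∈ W′ × η x r ≡ true}
      ... | yes (r , r∈ , xr) with canonical-descent closed r∈ xr
      ...   | c , K , xc = extend-back K x∈ ascˣ xc (go (rec (+-monoˡ-< (ℓ y) (η-true⇒ℓ> xc)))
                (conj-∙ (∈V K) x∈)
                (≈⟨⟩ (solve [] (x ∷ y ∷ c ∷ []) (var 1F ⊙ var 0F ⁻ ⊙ var 2F ⁻) (var 1F ⊙ (var 2F ⊙ var 0F) ⁻) refl)
                     (∙⟨⟩ yx⁻¹∈ (⁻¹⟨⟩ (∈V K))))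
                (ascent-descent K x∈ ascˣ xc) ascʸ)
      go {x} {y} (acc rec) x∈ yx⁻¹∈ ascˣ ascʸ | no noneˣ with em {P = ∃ λ r → r ∈ W′ × η y r ≡ true}
      ... | yes (r , r∈ , yr) with canonical-descent closed r∈ yr
      ...   | c , K , yc = swap (extend-back K y∈ ascʸ yc (swap (go (rec (+-monoʳ-< (ℓ x) (η-true⇒ℓ> yc)))
                x∈ (≈⟨⟩ (G.sym (G.assoc _ _ _)) (∙⟨⟩ (∈V K) yx⁻¹∈)) ascˣ (ascent-descent K y∈ ascʸ yc))))
        where
        y∈ = conj-coset x∈ yx⁻¹∈
      -- Neither N(x) nor N(y) meets W′, so by the cocycle neither does N(yx⁻¹): the bottom of the
      -- coset is unique.
      go {x} {y} (acc rec) x∈ yx⁻¹∈ ascˣ ascʸ | no noneˣ | no noneʸ =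
        inj₂ (done (x∙y⁻¹≈ε⇒x≈y y x (no-descent⇒ε yx⁻¹∈ λ {r} r∈ → begin
          η (y ∙ x ⁻¹) r                     ≡⟨ η-∙ y (x ⁻¹) r ⟩
          η y r xor η (x ⁻¹) (r ^ y)         ≡⟨ cong₂ _xor_ (¬-not λ eq → noneʸ (_ , r∈ , eq)) (η-⁻¹ x _) ⟩
          η x (r ^ y ^ x ⁻¹)                 ≡⟨ η-cong G.refl (^-∙ r y (x ⁻¹)) ⟨
          η x (r ^ (y ∙ x ⁻¹))               ≡⟨ ¬-not (λ eq → noneˣ (_ , W′-^ r∈ yx⁻¹∈ , eq)) ⟩
          false                              ∎)))
        where open ≡-Reasoning

  -- Minimal coset representatives

  module _ (J : Pred S a) where

    descent? : ∀ w → (∃ λ s → s ∈ J × ℓ (w ∙ gen s) < ℓ w) ⊎ w ∈ W^[ J ]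
    descent? w with em {P = ∃ λ s → s ∈ J × ℓ (w ∙ gen s) < ℓ w}
    ... | yes descent = inj₁ descent
    ... | no none     = inj₂ λ s s∈J → Ascent⇒ℓ< {s} {w} (¬-not λ eq → none (s , s∈J ,
      subst (_< ℓ w) (ℓ-cong (∙gen≈ w s)) (η-true⇒ℓ> eq)))

    JWord : Pred W a
    JWord w = ∃ λ u → All J u × ⟦ u ⟧ ≈ w

    W[J]-word : ∀ {w} → w ∈ W[ J ] → JWord w × JWord (w ⁻¹)
    W[J]-word (gen⟨⟩ (s , s∈J , w≈s)) =
      (s ∷ [] , s∈J ∷ [] , G.trans (G.identityʳ _) (G.sym w≈s)) ,
      (s ∷ [] , s∈J ∷ [] , G.trans (solve (genᵢ s ∷ []) [] (inv 0F ⊙ one) (inv 0F ⁻) refl) (G.⁻¹-cong (G.sym w≈s)))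
    W[J]-word ε⟨⟩ = ([] , [] , G.refl) , ([] , [] , solve [] [] one (one ⁻) refl)
    W[J]-word (∙⟨⟩ v∈ w∈) with W[J]-word v∈ | W[J]-word w∈
    ... | (p , Jp , p≈) , (p′ , Jp′ , p′≈) | (q , Jq , q≈) , (q′ , Jq′ , q′≈) =
      (p ++ q , ++⁺ Jp Jq , G.trans (⟦++⟧ p q) (G.∙-cong p≈ q≈)) ,
      (q′ ++ p′ , ++⁺ Jq′ Jp′ , G.trans (⟦++⟧ q′ p′) (G.trans (G.∙-cong q′≈ p′≈) (G.sym (⁻¹-anti-homo-∙ _ _))))
    W[J]-word (⁻¹⟨⟩ {w} w∈) with W[J]-word w∈
    ... | (p , Jp , p≈) , p′ = p′ , (p , Jp , G.trans p≈ (solve [] (w ∷ []) (var 0F) (var 0F ⁻ ⁻) refl))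
    W[J]-word (≈⟨⟩ v≈w v∈) with W[J]-word v∈
    ... | (p , Jp , p≈) , (p′ , Jp′ , p′≈) =
      (p , Jp , G.trans p≈ v≈w) , (p′ , Jp′ , G.trans p′≈ (G.⁻¹-cong v≈w))

    -- The first letter s of a J-word su is a descent unless s has odd count in u. In that case
    -- deletion turns su into a shorter J-word for the same element.
    W[J]-descent : ∀ {w} → w ∈ W[ J ] → w ≉ ε → ∃ λ s → s ∈ J × η w (gen s) ≡ true
    W[J]-descent w∈ w≉ε with W[J]-word w∈
    ... | (u , Ju , u≈w) , _ = descend u (<-wellFounded (length u)) Ju u≈w w≉ε
      where
      descend : ∀ u {w} → Acc _<_ (length u) → All J u → ⟦ u ⟧ ≈ w → w ≉ ε → ∃ λ s → s ∈ J × η w (gen s) ≡ true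
      descend []      _         _          ε≈w w≉ε = contradiction (G.sym ε≈w) w≉ε
      descend (s ∷ u) {w} (acc rec) (s∈J ∷ Ju) u≈w w≉ε with count u (gen s) in eq
      ... | false = s , s∈J , trans (η-word (s ∷ u) u≈w (gen s)) (cong₂ _xor_ (≟-true G.refl) (trans (count-cong u
              (solve (genᵢ s ∷ []) [] (inv 0F ⁻ ⊙ inv 0F ⊙ inv 0F) (inv 0F) refl)) eq))
      ... | true with deletion u (gen s) eq
      ...   | _ , v , su≈v , lt , all = descend v (rec (<-trans lt ≤-refl)) (all Ju) (G.trans (G.sym su≈v) u≈w) w≉ε

    CosetMinimal : Pred W a
    CosetMinimal b = ∀ {y} → y ∈ W[ J ] → ℓ b ≤ ℓ (b ∙ y)

    coset-minimum : ∀ b → ∃ λ y → y ∈ W[ J ] × CosetMinimal (b ∙ y)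
    coset-minimum b₀ = search b₀ (<-wellFounded (ℓ b₀))
      where
      search : ∀ b → Acc _<_ (ℓ b) → ∃ λ y → y ∈ W[ J ] × CosetMinimal (b ∙ y)
      search b (acc rec) with em {P = ∃ λ y → y ∈ W[ J ] × ℓ (b ∙ y) < ℓ b}
      ... | no none = ε , ε⟨⟩ , λ {y} y∈ → ≮⇒≥ λ lt → none (y , y∈ ,
              subst₂ _<_ (ℓ-cong (G.∙-congʳ (G.identityʳ b))) (ℓ-cong (G.identityʳ b)) lt)
      ... | yes (y , y∈ , lt) with search (b ∙ y) (rec lt)
      ...   | z , z∈ , min = y ∙ z , ∙⟨⟩ y∈ z∈ , λ {x} x∈ →
              subst₂ _≤_ (ℓ-cong (G.assoc b y z)) (ℓ-cong (G.∙-congʳ (G.assoc b y z))) (min x∈)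

    W^-resp : ∀ {v w} → v ≈ w → v ∈ W^[ J ] → w ∈ W^[ J ]
    W^-resp v≈w v∈ s s∈J = subst₂ _<_ (ℓ-cong v≈w) (ℓ-cong (G.∙-congʳ v≈w)) (v∈ s s∈J)

    -- If y ≠ ε, it has a right descent s in J. The conjugate of s by by lies in bW_Jb⁻¹, so it is
    -- not in N(b) by minimality, and s stays a right descent of by.
    minimal∙⇒ε : ∀ {b y} → CosetMinimal b → y ∈ W[ J ] → b ∙ y ∈ W^[ J ] → y ≈ ε
    minimal∙⇒ε {b} {y} min y∈ by∈ with em {P = y ≈ ε}
    ... | yes y≈ε = y≈ε
    ... | no y≉ε with W[J]-descent (⁻¹⟨⟩ y∈) (λ e → y≉ε (G.trans
                        (solve [] (y ∷ []) (var 0F) (var 0F ⁻ ⁻) refl) (G.trans (G.⁻¹-cong e) (solve [] [] (one ⁻) one refl))))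
    ...   | s , s∈J , y⁻¹s = contradiction (trans (sym ((ℓ<⇒Ascent (by∈ s s∈J)))) (begin
      η (b ∙ y) r                       ≡⟨ η-∙ b y r ⟩
      η b r xor η y (r ^ b)             ≡⟨ cong₂ _xor_ (¬-not not-below) (η-cong G.refl r^b) ⟩
      η y (gen s ^ y ⁻¹)                ≡⟨ η-⁻¹ y (gen s) ⟨
      η (y ⁻¹) (gen s)                  ≡⟨ y⁻¹s ⟩
      true                              ∎)) λ ()
      where
      open ≡-Reasoning
      r = (b ∙ y) · s ·⁻¹
      r^b : r ^ b ≈ gen s ^ y ⁻¹
      r^b = solve [] (b ∷ y ∷ gen s ∷ []) (var 0F ⁻ ⊙ (var 0F ⊙ var 1F ⊙ var 2F ⊙ (var 0F ⊙ var 1F) ⁻) ⊙ var 0F)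
                     (var 1F ⁻ ⁻ ⊙ var 2F ⊙ var 1F ⁻) refl
      r∙b : r ∙ b ≈ b ∙ (y · s ·⁻¹)
      r∙b = solve [] (b ∷ y ∷ gen s ∷ []) (var 0F ⊙ var 1F ⊙ var 2F ⊙ (var 0F ⊙ var 1F) ⁻ ⊙ var 0F)
                     (var 0F ⊙ (var 1F ⊙ var 2F ⊙ var 1F ⁻)) refl
      not-below : ¬ (η b r ≡ true)
      not-below eq = <⇒≱ (subst (_< ℓ b) (ℓ-cong r∙b) (η-true⇒ℓ> eq))
        (min (∙⟨⟩ (∙⟨⟩ y∈ (gen⟨⟩ (s , s∈J , G.refl))) (⁻¹⟨⟩ y∈)))

    -- Both elements are compared with a shortest element of the coset bW_J, and each equals it.
    W^-unique : ∀ {b d z} → b ∈ W^[ J ] → d ∈ W^[ J ] → z ∈ W[ J ] → d ≈ b ∙ z → d ≈ b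
    W^-unique {b} {d} {z} b∈ d∈ z∈ d≈bz with coset-minimum b
    ... | y , y∈ , min = G.trans (at-minimum (∙⟨⟩ (⁻¹⟨⟩ y∈) z∈) (G.trans d≈bz
            (solve [] (b ∷ y ∷ z ∷ []) (var 0F ⊙ var 2F) (var 0F ⊙ var 1F ⊙ (var 1F ⁻ ⊙ var 2F)) refl)) d∈)
          (G.sym (at-minimum (⁻¹⟨⟩ y∈)
            (solve [] (b ∷ y ∷ []) (var 0F) (var 0F ⊙ var 1F ⊙ var 1F ⁻) refl) b∈))
      where
      at-minimum : ∀ {x e} → x ∈ W[ J ] → e ≈ b ∙ y ∙ x → e ∈ W^[ J ] → e ≈ b ∙ y
      at-minimum x∈ e≈ e∈ = G.trans e≈ (G.trans (G.∙-congˡ (minimal∙⇒ε min x∈ (W^-resp e≈ e∈))) (G.identityʳ _))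

    -- The factorisation is built from arbitrary choices of descents; uniqueness makes its first
    -- factor depend only on the coset wW_J.
    P^-coset : ∀ {v w z} → z ∈ W[ J ] → w ≈ v ∙ z → P^ J w ≈ P^ J v
    P^-coset {v} {w} {z} z∈ w≈vz = W^-unique V.w^J∈W^J U.w^J∈W^J
      (∙⟨⟩ (∙⟨⟩ V.w_J∈W_J z∈) (⁻¹⟨⟩ U.w_J∈W_J))
      (G.trans (solve [] (U.w^J ∷ U.w_J ∷ []) (var 0F) (var 0F ⊙ var 1F ⊙ var 1F ⁻) refl)
        (G.trans (G.∙-congʳ (G.trans (G.sym U.product) (G.trans w≈vz (G.∙-congʳ V.product))))
          (solve [] (V.w^J ∷ V.w_J ∷ z ∷ U.w_J ∷ []) (var 0F ⊙ var 1F ⊙ var 2F ⊙ var 3F ⁻)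
            (var 0F ⊙ (var 1F ⊙ var 2F ⊙ var 3F ⁻)) refl)))
      where
      module U = Factorisation (factorisation J w)
      module V = Factorisation (factorisation J v)

    P^-cong : ∀ {v w} → v ≈ w → P^ J v ≈ P^ J w
    P^-cong v≈w = P^-coset ε⟨⟩ (G.trans v≈w (G.sym (G.identityʳ _)))

    P^-∙gen : ∀ w {s} → s ∈ J → P^ J (w ∙ gen s) ≈ P^ J w
    P^-∙gen w s∈J = P^-coset (gen⟨⟩ (_ , s∈J , G.refl)) G.refl

    P^-fixed : ∀ {w} → w ∈ W^[ J ] → w ≈ P^ J w
    P^-fixed {w} w∈ = W^-unique w^J∈W^J w∈ w_J∈W_J product
      where open Factorisation (factorisation J w)

  -- Chains and their projections

  module _ {X : Pred W a} (X⊆T : X ⊆ T) where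

    chain-respˡ : ∀ {u u′ v} → u ≈ u′ → Chain X u v → Chain X u′ v
    chain-respˡ u≈u′ (done u≈v) = done (G.trans (G.sym u≈u′) u≈v)
    chain-respˡ u≈u′ (step t t∈X u<tu chain) = step t t∈X
      (up⇒<ᴮ (X⊆T t∈X) G.refl (subst₂ _<_ (ℓ-cong u≈u′) (ℓ-cong (G.∙-congˡ u≈u′)) (<ᴮ⇒ℓ< u<tu)))
      (chain-respˡ (G.∙-congˡ u≈u′) chain)

    chain-trans : ∀ {u v w} → Chain X u v → Chain X v w → Chain X u w
    chain-trans (done u≈v)              chain = chain-respˡ (G.sym u≈v) chain
    chain-trans (step t t∈X u<tu chain) chain′ = step t t∈X u<tu (chain-trans chain chain′)

    chain⇒≤L : ∀ {u v} → Chain X u v → u ≤L[ X ] v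
    chain⇒≤L (done u≈v) = inj₁ u≈v
    chain⇒≤L chain@(step t t∈X u<tu rest) with chain⇒≤L rest
    ... | inj₁ tu≈v     = inj₂ (subst (_ <_) (ℓ-cong tu≈v) (<ᴮ⇒ℓ< u<tu) , chain)
    ... | inj₂ (lt , _) = inj₂ (<-trans (<ᴮ⇒ℓ< u<tu) lt , chain)

  ≤L⇒chain : ∀ {X u v} → u ≤L[ X ] v → Chain X u v
  ≤L⇒chain (inj₁ u≈v)         = done u≈v
  ≤L⇒chain (inj₂ (_ , chain)) = chain

  module _ (J : Pred S a) {X : Pred W a} (ideal : IsOrderIdeal X) where
    open IsOrderIdeal ideal renaming (closed to downward-closed)

    private
      P = P^ J

    Projects : Pred W a
    Projects t = ∀ u → ℓ u < ℓ (t ∙ u) → Chain X (P u) (P (t ∙ u))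

    project-across : ∀ {t u s} → t ∈ X → ℓ u < ℓ (t ∙ u) → s ∈ J → ℓ (u ∙ gen s) < ℓ u → ℓ (t ∙ u) < ℓ (t ∙ u ∙ gen s) →
                     (∀ {c} → c ∈ X → ℓ c < ℓ t → Projects c) → Chain X (P u) (P (t ∙ u))
    project-across {t} {u} {s} t∈X u<tu s∈J us<u tu<tus below = result (compare x-conj vx⁻¹∈ asc-x asc-v)
      where
      t∈T = X⊆T t∈X
      t≉usu⁻¹ : t ≉ u · s ·⁻¹
      t≉usu⁻¹ e = <-asym u<tu (subst (_< ℓ u) (ℓ-cong (G.sym (G.trans (G.∙-congʳ e) (∙gen≈ u s)))) us<u)
      open Climbing t∈T (·⁻¹∈T u s) t≉usu⁻¹ s
      x = u ∙ gen s
      v = t ∙ u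
      x-conj : (x · s ·⁻¹) ∈ W′
      x-conj = ≈⟨⟩ (solve (genᵢ s ∷ []) (u ∷ []) (var 0F ⊙ inv 0F ⊙ var 0F ⁻)
                     (var 0F ⊙ inv 0F ⊙ inv 0F ⊙ (var 0F ⊙ inv 0F) ⁻) refl) q∈W′
      vx⁻¹∈ : v ∙ x ⁻¹ ∈ W′
      vx⁻¹∈ = ≈⟨⟩ (solve (genᵢ s ∷ []) (u ∷ t ∷ []) (var 1F ⊙ (var 0F ⊙ inv 0F ⊙ var 0F ⁻))
                    (var 1F ⊙ var 0F ⊙ (var 0F ⊙ inv 0F) ⁻) refl) (∙⟨⟩ p∈W′ q∈W′)
      asc-x : Ascent s x
      asc-x = ℓ<⇒Ascent (subst (ℓ x <_) (ℓ-cong (G.sym (∙gen-gen u s))) us<u)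
      asc-v : Ascent s v
      asc-v = ℓ<⇒Ascent tu<tus
      tv≈u : t ∙ v ≈ u
      tv≈u = T-cancel t∈T u
      -- If t were canonical it would be a canonical descent of tu; removing it would keep the
      -- ascent at s and give u < us.
      t-not-canonical : ¬ Canonical W′ t
      t-not-canonical K = <-asym us<u (Ascent⇒ℓ< (Ascent-resp tv≈u (ascent-descent K (conj-coset x-conj vx⁻¹∈) asc-v
        (ℓ>⇒η-true t∈T (subst (_< ℓ v) (ℓ-cong (G.sym tv≈u)) u<tu)))))
      -- Downward closure of X enters here: a directed walk from c to t inside W′ is precisely c ⊑
      -- t. The walk is not constant, as t is not canonical, so the length drops strictly.
      canonical-below : ∀ {c} → Canonical W′ c → c ∈ X × ℓ c < ℓ t
      canonical-below {c} K with reach p∈W′ K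
      ... | inj₁ t≈ε        = contradiction t≈ε (T≉ε t∈T)
      ... | inj₂ (inj₁ K′)  = contradiction K′ t-not-canonical
      ... | inj₂ (inj₂ (n , walk)) =
        downward-closed [ ∈T K , t∈T , inj₂ (W′ , isReflectionSubgroup , isDihedral , ∈V K , p∈W′ , n , walk) ] t∈X , shorter (walk-ℓ walk)
        where
        shorter : c ≈ t ⊎ ℓ c < ℓ t → ℓ c < ℓ t
        shorter (inj₁ c≈t) = contradiction (Canonical-resp closed c≈t K) t-not-canonical
        shorter (inj₂ lt)  = lt
      project-climb : ∀ {y z} → Climb y z → Chain X (P y) (P z)
      project-climb (done y≈z) = done (P^-cong J y≈z)
      project-climb (step c K lt _ climb) = let c∈X , c<t = canonical-below K in
        chain-trans X⊆T (below c∈X c<t _ lt) (project-climb climb)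
      result : Climb x v ⊎ Climb v x → Chain X (P u) (P v)
      result (inj₁ climb) = chain-respˡ X⊆T (P^-∙gen J u s∈J) (project-climb climb)
      result (inj₂ climb) = contradiction (climb-ℓ climb) (<⇒≱ (<-trans us<u u<tu))

    project-from-below : ∀ {t} → t ∈ X → (∀ {c} → c ∈ X → ℓ c < ℓ t → Projects c) →
                         ∀ u → Acc _<_ (ℓ (t ∙ u)) → ℓ u < ℓ (t ∙ u) → Chain X (P u) (P (t ∙ u))
    project-from-below {t} t∈X below u (acc rec) u<tu with descent? J (t ∙ u)
    ... | inj₁ (s , s∈J , lt) with toSum (em {P = t ^ u ≈ gen s})
    ...   | inj₁ t^u≈s = done (G.sym (G.trans (P^-cong J tu≈us) (P^-∙gen J u s∈J)))
      where
      tu≈us : t ∙ u ≈ u ∙ gen s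
      tu≈us = G.trans (G.∙-congʳ (^≈⇒≈ u t^u≈s)) (∙gen≈ u s)
    -- N(us) is N(u) with usu⁻¹ toggled. As t differs from usu⁻¹ it stays outside, so us < tus and
    -- the same t serves for the shorter pair.
    ...   | inj₂ t^u≉s = chain-trans X⊆T (chain-respˡ X⊆T (P^-∙gen J u s∈J)
              (project-from-below t∈X below (u ∙ gen s) (rec (subst (_< ℓ (t ∙ u)) (ℓ-cong (G.assoc t u (gen s))) lt))
                (η-false⇒ℓ< (X⊆T t∈X) us-t)))
              (done (G.trans (P^-cong J (G.sym (G.assoc t u (gen s)))) (P^-∙gen J (t ∙ u) s∈J)))
      where
      us-t : η (u ∙ gen s) t ≡ false
      us-t = trans (η-∙ u (gen s) t) (cong₂ _xor_ (ℓ<⇒η-false u<tu) (trans (η-gen s _) (≟-false t^u≉s)))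
    project-from-below {t} t∈X below u (acc rec) u<tu | inj₂ tu∈ with descent? J u
    ... | inj₁ (s , s∈J , lt) = project-across t∈X u<tu s∈J lt (tu∈ s s∈J) below
    ... | inj₂ u∈ = chain-respˡ X⊆T (P^-fixed J u∈)
              (step t t∈X (up⇒<ᴮ (X⊆T t∈X) G.refl u<tu) (done (P^-fixed J tu∈)))

    -- The outer induction on ℓ(t). `Projects` quantifies over every u because the climb applies the
    -- shorter reflections at other elements of the coset.
    project-step : ∀ {t} → Acc _<_ (ℓ t) → t ∈ X → Projects t
    project-step (acc rec) t∈X u =
      project-from-below t∈X (λ c∈X c<t → project-step (rec c<t) c∈X) u (<-wellFounded _)

    project-chain : ∀ {u v} → Chain X u v → Chain X (P u) (P v)
    project-chain (done u≈v) = done (P^-cong J u≈v)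
    project-chain (step t t∈X u<tu chain) = chain-trans X⊆T
      (project-step (<-wellFounded _) t∈X _ (<ᴮ⇒ℓ< u<tu)) (project-chain chain)

  -- The intermediate orders

  ⊑′⇒ℓ≤ : ∀ {t t′} → t ⊑′ t′ → ℓ t ≤ ℓ t′
  ⊑′⇒ℓ≤ (_ , _ , inj₁ t≈t′) = ≤-reflexive (ℓ-cong t≈t′)
  ⊑′⇒ℓ≤ (_ , _ , inj₂ (_ , _ , _ , _ , _ , _ , walk)) with walk-ℓ walk
  ... | inj₁ t≈t′ = ≤-reflexive (ℓ-cong t≈t′)
  ... | inj₂ lt   = <⇒≤ lt

  T[k]-ideal : ∀ k → IsOrderIdeal T[ k ]
  T[k]-ideal k = record { X⊆T = proj₁ ; closed = down }
    where
    down′ : ∀ {t t′} → t ⊑′ t′ → t′ ∈ T[ k ] → t ∈ T[ k ]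
    down′ t⊑t′ (_ , ≤k) = proj₁ t⊑t′ , ≤-trans (/-monoˡ-≤ 2 (∸-monoˡ-≤ 1 (⊑′⇒ℓ≤ t⊑t′))) ≤k
    down : ∀ {t t′} → t ⊑ t′ → t′ ∈ T[ k ] → t ∈ T[ k ]
    down [ t⊑t′ ]        t′∈ = down′ t⊑t′ t′∈
    down (t⊑t″ ∷ t″⊑t′) t′∈ = down′ t⊑t″ (down t″⊑t′ t′∈)

  P^-monotone : ∀ J {X} → IsOrderIdeal X → ∀ u v → u ≤L[ X ] v → P^ J u ≤L[ X ] P^ J v
  P^-monotone J ideal u v u≤v = chain⇒≤L (IsOrderIdeal.X⊆T ideal) (project-chain J ideal (≤L⇒chain u≤v))

theorem3p8 : (em : ∀ {p} → ExcludedMiddle p) {a : Level} (C : CoxeterSystem a) →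
    let open Coxeter em C in
    (J : Pred S a) →
    ((X : Pred W a) → IsOrderIdeal X → ∀ u v → u ≤L[ X ] v → P^ J u ≤L[ X ] P^ J v) ×
    ((k : ℕ) → ∀ u v → u ≤L[ T[ k ] ] v → P^ J u ≤L[ T[ k ] ] P^ J v)
theorem3p8 em C J = (λ _ ideal → P^-monotone J ideal) , (λ k → P^-monotone J (T[k]-ideal k))
  where open CoxeterProperties em C
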